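{- For every integer base $g\ge 2$, the sequence $(s(n))_{n\ge 2}$ is not Benford with respect to natural density in base $g$.
   Context: For a positive integer $n$, $s(n)=\sum_{d\mid n,\ d<n} d=\sigma(n)-n$ is the sum of proper divisors of $n$. A sequence of positive integers $(a_n)_{n\ge 2}$ is Benford in base $g$ with respect to natural density if, for each positive integer $D$, the set of $n\ge2$ for which the base-$g$ expansion of $a_n$ begins with the block of base-$g$ digits of $D$ (i.e. $Dg^{j}\le a_n<(D+1)g^{j}$ for some integer $j\ge 0$) has a natural density, equal to $\log_g(1+1/D)$. The natural density of $A\subseteq\mathbb{N}$ is $\lim_{x\to\infty}\frac1x\#\{n\le x:n\in A\}$, when this limit exists. -}

module Defs where

open import Data.Integer.Base as ℤ using (ℤ; +_; -[1+_]; _⊖_)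
import Data.Integer.Properties as ℤ
open import Data.List.Base using (filter; length; upTo)
open import Data.Nat.Base
open import Data.Nat.Divisibility using (_∣?_)
open import Data.Nat.ListAction using (sum)
open import Data.Nat.Properties
open import Data.Nat.Solver using (module +-*-Solver)
open import Data.Product.Base using (∃; _×_; _,_)
open import Data.Rational.Unnormalised.Base as ℚ
  using (ℚᵘ; mkℚᵘ; 0ℚᵘ; ↥_; ↧ₙ_; *<*; *≤*)
open import Data.Sum.Base using (_⊎_; inj₁; inj₂)
open import Relation.Binary.PropositionalEquality
open import Relation.Nullary.Decidable using (Dec; yes; no; map′; _×-dec_)
open import Relation.Nullary.Negation using (¬_; contradiction)
open import Relation.Unary using (Pred; Decidable)
open import Level using (0ℓ)

-- Two-sided Dedekind cuts of ℚ.
record ℝ : Set₁ where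
  field
    Lower Upper : Pred ℚᵘ 0ℓ      -- Lower q: q < x;  Upper q: x < q
    lower-inhabited : ∃ Lower
    upper-inhabited : ∃ Upper
    lower-down : ∀ {q r} → q ℚ.≤ r → Lower r → Lower q
    upper-up   : ∀ {q r} → q ℚ.≤ r → Upper q → Upper r
    lower-open : ∀ {q} → Lower q → ∃ λ r → q ℚ.< r × Lower r
    upper-open : ∀ {q} → Upper q → ∃ λ r → r ℚ.< q × Upper r
    disjoint   : ∀ {q} → Lower q → ¬ Upper q
    located    : ∀ {q r} → q ℚ.< r → Lower q ⊎ Upper r

-- ∣ q - x ∣ < ε, as q - ε < x < q + ε.
Within : ℚᵘ → ℚᵘ → ℝ → Set
Within ε q x = ℝ.Lower x (q ℚ.- ε) × ℝ.Upper x (q ℚ.+ ε)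

posPart negPart : ℤ → ℕ
posPart (+ n)    = n
posPart -[1+ n ] = 0
negPart (+ n)    = 0
negPart -[1+ n ] = suc n

-- For a rational q = p / b with b > 0 and an integer base g ≥ 2,
--   q < log_g (m / k)  iff  g ^ p < (m / k) ^ b
--                      iff  g ^ p⁺ * k ^ b < m ^ b * g ^ p⁻ ,
-- where p = p⁺ - p⁻, and likewise for the opposite inequality.
module Cut (g m k : ℕ) where

  lhs rhs : ℚᵘ → ℕ
  lhs q = g ^ posPart (↥ q) * k ^ ↧ₙ q
  rhs q = m ^ ↧ₙ q * g ^ negPart (↥ q)

  BelowLog AboveLog : Pred ℚᵘ 0ℓ
  BelowLog q = lhs q < rhs q
  AboveLog q = rhs q < lhs q

private

  posPart-* : ∀ i c → posPart (i ℤ.* + suc c) ≡ posPart i * suc c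
  posPart-* (+ n)    c = cong posPart (sym (ℤ.pos-* n (suc c)))
  posPart-* -[1+ n ] c = refl

  negPart-* : ∀ i c → negPart (i ℤ.* + suc c) ≡ negPart i * suc c
  negPart-* (+ n)    c = cong negPart (sym (ℤ.pos-* n (suc c)))
  negPart-* -[1+ n ] c = refl

  parts-≤ : ∀ {i j} → i ℤ.≤ j → posPart i + negPart j ≤ posPart j + negPart i
  parts-≤ (ℤ.-≤- n≤m) = s≤s n≤m
  parts-≤ ℤ.-≤+       = z≤n
  parts-≤ (ℤ.+≤+ m≤n) = +-monoˡ-≤ 0 m≤n

  parts-< : ∀ {i j} → i ℤ.< j → posPart i + negPart j < posPart j + negPart i
  parts-< (ℤ.-<- n<m)         = s≤s n<m
  parts-< (ℤ.-<+ {m} {n})     = ≤-trans (s≤s z≤n) (m≤n+m (suc m) n)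
  parts-< (ℤ.+<+ m<n)         = +-monoˡ-< 0 m<n

  parts-<⁻¹ : ∀ i j → posPart i + negPart j < posPart j + negPart i → i ℤ.< j
  parts-<⁻¹ (+ m)    (+ n)    p         = ℤ.+<+ (+-cancelʳ-< 0 m n p)
  parts-<⁻¹ (+ m)    -[1+ n ] p         = contradiction p n≮0
  parts-<⁻¹ -[1+ m ] (+ n)    p         = ℤ.-<+
  parts-<⁻¹ -[1+ m ] -[1+ n ] (s≤s p)   = ℤ.-<- p

  parts-⊖ : ∀ x y → x + negPart (x ⊖ y) ≡ y + posPart (x ⊖ y)
  parts-⊖ zero    zero    = refl
  parts-⊖ zero    (suc y) = sym (+-identityʳ (suc y))
  parts-⊖ (suc x) zero    = +-identityʳ (suc x)
  parts-⊖ (suc x) (suc y) rewrite ℤ.[1+m]⊖[1+n]≡m⊖n x y = cong suc (parts-⊖ x y)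

  cross-parts : ∀ i j b c →
    posPart (i ℤ.* + suc c) + negPart (j ℤ.* + suc b) ≡
    posPart i * suc c + negPart j * suc b
  cross-parts i j b c = cong₂ _+_ (posPart-* i c) (negPart-* j b)

  cross-≤ : ∀ {q r} → q ℚ.≤ r →
    posPart (↥ q) * ↧ₙ r + negPart (↥ r) * ↧ₙ q ≤
    posPart (↥ r) * ↧ₙ q + negPart (↥ q) * ↧ₙ r
  cross-≤ {mkℚᵘ i b} {mkℚᵘ j c} (*≤* p) =
    subst₂ _≤_ (cross-parts i j b c) (cross-parts j i c b) (parts-≤ p)

  cross-< : ∀ {q r} → q ℚ.< r →
    posPart (↥ q) * ↧ₙ r + negPart (↥ r) * ↧ₙ q <
    posPart (↥ r) * ↧ₙ q + negPart (↥ q) * ↧ₙ r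
  cross-< {mkℚᵘ i b} {mkℚᵘ j c} (*<* p) =
    subst₂ _<_ (cross-parts i j b c) (cross-parts j i c b) (parts-< p)

  cross-<⁻¹ : ∀ q r →
    posPart (↥ q) * ↧ₙ r + negPart (↥ r) * ↧ₙ q <
    posPart (↥ r) * ↧ₙ q + negPart (↥ q) * ↧ₙ r → q ℚ.< r
  cross-<⁻¹ (mkℚᵘ i b) (mkℚᵘ j c) p = *<* (parts-<⁻¹ _ _
    (subst₂ _<_ (sym (cross-parts i j b c)) (sym (cross-parts j i c b)) p))

  ^-distribʳ-* : ∀ m n o → (m * n) ^ o ≡ m ^ o * n ^ o
  ^-distribʳ-* m n zero    = refl
  ^-distribʳ-* m n (suc o) = trans (cong (m * n *_) (^-distribʳ-* m n o))
    (solve 4 (λ m n x y → m :* n :* (x :* y) := m :* x :* (n :* y)) refl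
      m n (m ^ o) (n ^ o))
    where
    open +-*-Solver

  ^-cancelˡ-< : ∀ o {m n} → m ^ o < n ^ o → m < n
  ^-cancelˡ-< o p = ≰⇒> λ n≤m → <⇒≱ p (^-monoˡ-≤ o n≤m)

  bernoulli : ∀ a n → a ^ suc n + suc n * a ^ n ≤ suc a ^ suc n
  bernoulli a zero    = ≤-reflexive (solve 1 (λ a →
    a :* con 1 :+ con 1 := (con 1 :+ a) :* con 1) refl a)
    where
    open +-*-Solver
  bernoulli a (suc n) = ≤-trans
    (≤-trans (m≤m+n _ (suc n * a ^ n)) (≤-reflexive (solve 3 (λ a n x →
      a :* (a :* x) :+ (con 2 :+ n) :* (a :* x) :+ (con 1 :+ n) :* x
        := (con 1 :+ a) :* (a :* x :+ (con 1 :+ n) :* x)) refl a n (a ^ n))))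
    (*-monoʳ-≤ (suc a) (bernoulli a n))
    where
    open +-*-Solver

  amplify : ∀ g {a b} → a < b → ∃ λ N → g * a ^ suc N < b ^ suc N
  amplify g {a} {b} a<b = g * a , (begin-strict
    g * a ^ suc N                      ≡⟨ *-assoc g a (a ^ N) ⟨
    N * a ^ N                          ≤⟨ m≤n+m (N * a ^ N) (a ^ suc N) ⟩
    a ^ suc N + N * a ^ N              <⟨ +-monoʳ-< (a ^ suc N) (m<n+m (N * a ^ N) (a^N>0 a)) ⟩
    a ^ suc N + suc N * a ^ N          ≤⟨ bernoulli a N ⟩
    suc a ^ suc N                      ≤⟨ ^-monoˡ-≤ (suc N) a<b ⟩
    b ^ suc N                          ∎)
    where
    open ≤-Reasoning
    N = g * a
    a^N>0 : ∀ a → 0 < a ^ (g * a)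
    a^N>0 zero    rewrite *-zeroʳ g = z<s
    a^N>0 (suc a) = m^n>0 (suc a) (g * suc a)

  n<g^n : ∀ {g} → 2 ≤ g → ∀ n → n < g ^ n
  n<g^n       2≤g zero    = ≤-refl
  n<g^n {g}   2≤g (suc n) = begin
    2 + n               ≤⟨ +-monoʳ-≤ 1 (n<g^n 2≤g n) ⟩
    1 + g ^ n           ≤⟨ +-monoˡ-≤ (g ^ n) (≤-trans (s≤s z≤n) (n<g^n 2≤g n)) ⟩
    g ^ n + g ^ n       ≡⟨ cong (_+_ (g ^ n)) (+-identityʳ (g ^ n)) ⟨
    2 * g ^ n           ≤⟨ *-monoˡ-≤ (g ^ n) 2≤g ⟩
    g * g ^ n           ∎
    where
    open ≤-Reasoning

  module CutProperties {g : ℕ} (2≤g : 2 ≤ g) (m k : ℕ)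
                       .{{_ : NonZero m}} .{{_ : NonZero k}} where

    open Cut g m k
    open +-*-Solver
    open ≤-Reasoning

    instance
      g≢0 : NonZero g
      g≢0 = >-nonZero (<⇒≤ 2≤g)

      lhs≢0 : ∀ {q} → NonZero (lhs q)
      lhs≢0 {q} = m*n≢0 _ _ {{m^n≢0 g (posPart (↥ q))}} {{m^n≢0 k (↧ₙ q)}}

      rhs≢0 : ∀ {q} → NonZero (rhs q)
      rhs≢0 {q} = m*n≢0 _ _ {{m^n≢0 m (↧ₙ q)}} {{m^n≢0 g (negPart (↥ q))}}

    pow : ∀ x a y b c → (x ^ a * y ^ b) ^ c ≡ x ^ (a * c) * y ^ (b * c)
    pow x a y b c = trans (^-distribʳ-* (x ^ a) (y ^ b) c)
      (cong₂ _*_ (^-*-assoc x a c) (^-*-assoc y b c))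

    cross : ∀ q r → lhs q ^ ↧ₙ r * rhs r ^ ↧ₙ q ≡
      g ^ (posPart (↥ q) * ↧ₙ r + negPart (↥ r) * ↧ₙ q) *
      (k ^ (↧ₙ q * ↧ₙ r) * m ^ (↧ₙ q * ↧ₙ r))
    cross q r = begin-equality
      lhs q ^ c * rhs r ^ b
        ≡⟨ cong₂ _*_ (pow g P k b c) (pow m c g M b) ⟩
      g ^ (P * c) * k ^ (b * c) * (m ^ (c * b) * g ^ (M * b))
        ≡⟨ cong (λ t → g ^ (P * c) * k ^ (b * c) * (m ^ t * g ^ (M * b))) (*-comm c b) ⟩
      g ^ (P * c) * k ^ (b * c) * (m ^ (b * c) * g ^ (M * b))
        ≡⟨ solve 4 (λ x y z w → x :* y :* (z :* w) := x :* w :* (y :* z)) refl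
             (g ^ (P * c)) (k ^ (b * c)) (m ^ (b * c)) (g ^ (M * b)) ⟩
      g ^ (P * c) * g ^ (M * b) * (k ^ (b * c) * m ^ (b * c))
        ≡⟨ cong (_* (k ^ (b * c) * m ^ (b * c))) (^-distribˡ-+-* g (P * c) (M * b)) ⟨
      g ^ (P * c + M * b) * (k ^ (b * c) * m ^ (b * c)) ∎
      where b = ↧ₙ q; c = ↧ₙ r; P = posPart (↥ q); M = negPart (↥ r)

    cross′ : ∀ q r → rhs q ^ ↧ₙ r * lhs r ^ ↧ₙ q ≡
      g ^ (posPart (↥ r) * ↧ₙ q + negPart (↥ q) * ↧ₙ r) *
      (k ^ (↧ₙ q * ↧ₙ r) * m ^ (↧ₙ q * ↧ₙ r))
    cross′ q r = trans (*-comm (rhs q ^ ↧ₙ r) (lhs r ^ ↧ₙ q)) (trans (cross r q)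
      (cong (λ t → g ^ (posPart (↥ r) * ↧ₙ q + negPart (↥ q) * ↧ₙ r) * (k ^ t * m ^ t))
        (*-comm (↧ₙ r) (↧ₙ q))))

    monotone-≤ : ∀ {q r} → q ℚ.≤ r →
      lhs q ^ ↧ₙ r * rhs r ^ ↧ₙ q ≤ rhs q ^ ↧ₙ r * lhs r ^ ↧ₙ q
    monotone-≤ {q} {r} q≤r = subst₂ _≤_ (sym (cross q r)) (sym (cross′ q r))
      (*-monoˡ-≤ _ (^-monoʳ-≤ g (cross-≤ q≤r)))

    monotone-< : ∀ {q r} → q ℚ.< r →
      lhs q ^ ↧ₙ r * rhs r ^ ↧ₙ q < rhs q ^ ↧ₙ r * lhs r ^ ↧ₙ q
    monotone-< {q} {r} q<r = subst₂ _<_ (sym (cross q r)) (sym (cross′ q r))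
      (*-monoˡ-< (k ^ e * m ^ e) {{m*n≢0 _ _ {{m^n≢0 k e}} {{m^n≢0 m e}}}}
        (^-monoʳ-< g 2≤g (cross-< q<r)))
      where e = ↧ₙ q * ↧ₙ r

    lower-down : ∀ {q r} → q ℚ.≤ r → BelowLog r → BelowLog q
    lower-down {q} {r} q≤r r< = ≰⇒> λ rq≤lq → <⇒≱ (begin-strict
      rhs q ^ ↧ₙ r * lhs r ^ ↧ₙ q
        <⟨ *-monoʳ-< (rhs q ^ ↧ₙ r) {{m^n≢0 _ (↧ₙ r) {{rhs≢0 {q}}}}} (^-monoˡ-< (↧ₙ q) r<) ⟩
      rhs q ^ ↧ₙ r * rhs r ^ ↧ₙ q
        ≤⟨ *-monoˡ-≤ (rhs r ^ ↧ₙ q) (^-monoˡ-≤ (↧ₙ r) rq≤lq) ⟩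
      lhs q ^ ↧ₙ r * rhs r ^ ↧ₙ q ∎) (monotone-≤ q≤r)

    upper-up : ∀ {q r} → q ℚ.≤ r → AboveLog q → AboveLog r
    upper-up {q} {r} q≤r q> = ≰⇒> λ lr≤rr → <⇒≱ (begin-strict
      rhs q ^ ↧ₙ r * lhs r ^ ↧ₙ q
        <⟨ *-monoˡ-< (lhs r ^ ↧ₙ q) {{m^n≢0 _ (↧ₙ q) {{lhs≢0 {r}}}}} (^-monoˡ-< (↧ₙ r) q>) ⟩
      lhs q ^ ↧ₙ r * lhs r ^ ↧ₙ q
        ≤⟨ *-monoʳ-≤ (lhs q ^ ↧ₙ r) (^-monoˡ-≤ (↧ₙ q) lr≤rr) ⟩
      lhs q ^ ↧ₙ r * rhs r ^ ↧ₙ q ∎) (monotone-≤ q≤r)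

    located : ∀ {q r} → q ℚ.< r → BelowLog q ⊎ AboveLog r
    located {q} {r} q<r with lhs q <? rhs q
    ... | yes q< = inj₁ q<
    ... | no  q≮ = inj₂ (^-cancelˡ-< (↧ₙ q) (*-cancelˡ-< (rhs q ^ ↧ₙ r) _ _
      (≤-<-trans (*-monoˡ-≤ (rhs r ^ ↧ₙ q) (^-monoˡ-≤ (↧ₙ r) (≮⇒≥ q≮)))
        (monotone-< q<r))))

    shift : ∀ x y → g ^ y * g ^ posPart (x ⊖ y) ≡ g ^ x * g ^ negPart (x ⊖ y)
    shift x y = trans (sym (^-distribˡ-+-* g y _))
      (trans (cong (g ^_) (sym (parts-⊖ x y))) (^-distribˡ-+-* g x _))

    toBelow : ∀ x y b → g ^ x * k ^ suc b < m ^ suc b * g ^ y → BelowLog (mkℚᵘ (x ⊖ y) b)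
    toBelow x y b p = *-cancelˡ-< (g ^ y) _ _ (begin-strict
      g ^ y * (G⁺ * K)   ≡⟨ *-assoc (g ^ y) G⁺ K ⟨
      g ^ y * G⁺ * K     ≡⟨ cong (_* K) (shift x y) ⟩
      g ^ x * G⁻ * K     ≡⟨ solve 3 (λ u v w → u :* v :* w := u :* w :* v) refl (g ^ x) G⁻ K ⟩
      g ^ x * K * G⁻     <⟨ *-monoˡ-< G⁻ {{m^n≢0 g (negPart (x ⊖ y))}} p ⟩
      M * g ^ y * G⁻     ≡⟨ solve 3 (λ u v w → u :* v :* w := v :* (u :* w)) refl M (g ^ y) G⁻ ⟩
      g ^ y * (M * G⁻)   ∎)
      where
      G⁺ = g ^ posPart (x ⊖ y); G⁻ = g ^ negPart (x ⊖ y); K = k ^ suc b; M = m ^ suc b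

    toAbove : ∀ x y b → m ^ suc b * g ^ y < g ^ x * k ^ suc b → AboveLog (mkℚᵘ (x ⊖ y) b)
    toAbove x y b p = *-cancelˡ-< (g ^ y) _ _ (begin-strict
      g ^ y * (M * G⁻)   ≡⟨ solve 3 (λ u v w → u :* v :* w := v :* (u :* w)) refl M (g ^ y) G⁻ ⟨
      M * g ^ y * G⁻     <⟨ *-monoˡ-< G⁻ {{m^n≢0 g (negPart (x ⊖ y))}} p ⟩
      g ^ x * K * G⁻     ≡⟨ solve 3 (λ u v w → u :* v :* w := u :* w :* v) refl (g ^ x) G⁻ K ⟨
      g ^ x * G⁻ * K     ≡⟨ cong (_* K) (shift x y) ⟨
      g ^ y * G⁺ * K     ≡⟨ *-assoc (g ^ y) G⁺ K ⟩
      g ^ y * (G⁺ * K)   ∎)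
      where
      G⁺ = g ^ posPart (x ⊖ y); G⁻ = g ^ negPart (x ⊖ y); K = k ^ suc b; M = m ^ suc b

    lower-open : ∀ {q} → BelowLog q → ∃ λ r → q ℚ.< r × BelowLog r
    lower-open {q@(mkℚᵘ i b)} q< with amplify g q<
    ... | N , p = r , cross-<⁻¹ q r q<r , toBelow x y (N + b * n) (begin-strict
      g * g ^ (P * n) * k ^ (suc b * n)     ≡⟨ *-assoc g (g ^ (P * n)) (k ^ (suc b * n)) ⟩
      g * (g ^ (P * n) * k ^ (suc b * n))   ≡⟨ cong (g *_) (pow g P k (suc b) n) ⟨
      g * lhs q ^ n                         <⟨ p ⟩
      rhs q ^ n                             ≡⟨ pow m (suc b) g M n ⟩
      m ^ (suc b * n) * g ^ (M * n)         ∎)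
      where
      n = suc N; P = posPart i; M = negPart i
      x = suc (P * n); y = M * n
      r = mkℚᵘ (x ⊖ y) (N + b * n)
      r⁺ = posPart (x ⊖ y); r⁻ = negPart (x ⊖ y)
      q<r : P * (suc b * n) + r⁻ * suc b < r⁺ * suc b + M * (suc b * n)
      q<r = begin-strict
        P * (suc b * n) + r⁻ * suc b
          <⟨ m<n+m _ {suc b} z<s ⟩
        suc b + (P * (suc b * n) + r⁻ * suc b)
          ≡⟨ solve 4 (λ P b n r → b :+ (P :* (b :* n) :+ r :* b)
               := (con 1 :+ P :* n :+ r) :* b) refl P (suc b) n r⁻ ⟩
        (x + r⁻) * suc b
          ≡⟨ cong (_* suc b) (parts-⊖ x y) ⟩
        (y + r⁺) * suc b
          ≡⟨ solve 4 (λ M b n r → (M :* n :+ r) :* b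
               := r :* b :+ M :* (b :* n)) refl M (suc b) n r⁺ ⟩
        r⁺ * suc b + M * (suc b * n) ∎

    upper-open : ∀ {q} → AboveLog q → ∃ λ r → r ℚ.< q × AboveLog r
    upper-open {q@(mkℚᵘ i b)} q> with amplify g q>
    ... | N , p = r , cross-<⁻¹ r q r<q , toAbove x y (N + b * n) (begin-strict
      m ^ (suc b * n) * (g * g ^ (M * n))
        ≡⟨ solve 3 (λ u v w → u :* (v :* w) := v :* (u :* w)) refl
             (m ^ (suc b * n)) g (g ^ (M * n)) ⟩
      g * (m ^ (suc b * n) * g ^ (M * n))   ≡⟨ cong (g *_) (pow m (suc b) g M n) ⟨
      g * rhs q ^ n                         <⟨ p ⟩
      lhs q ^ n                             ≡⟨ pow g P k (suc b) n ⟩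
      g ^ (P * n) * k ^ (suc b * n)         ∎)
      where
      n = suc N; P = posPart i; M = negPart i
      x = P * n; y = suc (M * n)
      r = mkℚᵘ (x ⊖ y) (N + b * n)
      r⁺ = posPart (x ⊖ y); r⁻ = negPart (x ⊖ y)
      r<q : r⁺ * suc b + M * (suc b * n) < P * (suc b * n) + r⁻ * suc b
      r<q = begin-strict
        r⁺ * suc b + M * (suc b * n)
          <⟨ m<n+m _ {suc b} z<s ⟩
        suc b + (r⁺ * suc b + M * (suc b * n))
          ≡⟨ solve 4 (λ M b n r → b :+ (r :* b :+ M :* (b :* n))
               := (con 1 :+ M :* n :+ r) :* b) refl M (suc b) n r⁺ ⟩
        (y + r⁺) * suc b
          ≡⟨ cong (_* suc b) (parts-⊖ x y) ⟨
        (x + r⁻) * suc b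
          ≡⟨ solve 4 (λ P b n r → (P :* n :+ r) :* b
               := P :* (b :* n) :+ r :* b) refl P (suc b) n r⁻ ⟩
        P * (suc b * n) + r⁻ * suc b ∎

    lower-inhabited : ∃ BelowLog
    lower-inhabited = mkℚᵘ (0 ⊖ k) 0 , toBelow 0 k 0 (begin-strict
      1 * (k * 1)     ≡⟨ solve 1 (λ k → con 1 :* (k :* con 1) := k) refl k ⟩
      k               <⟨ n<g^n 2≤g k ⟩
      g ^ k           ≤⟨ m≤n*m (g ^ k) (m * 1) {{m*n≢0 m 1}} ⟩
      m * 1 * g ^ k   ∎)

    upper-inhabited : ∃ AboveLog
    upper-inhabited = mkℚᵘ (m ⊖ 0) 0 , toAbove m 0 0 (begin-strict
      m * 1 * 1       ≡⟨ solve 1 (λ m → m :* con 1 :* con 1 := m) refl m ⟩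
      m               <⟨ n<g^n 2≤g m ⟩
      g ^ m           ≤⟨ m≤m*n (g ^ m) (k * 1) {{m*n≢0 k 1}} ⟩
      g ^ m * (k * 1) ∎)

-- The real number log_g (m / k).
log : (g : ℕ) → 2 ≤ g → (m k : ℕ) .{{_ : NonZero m}} .{{_ : NonZero k}} → ℝ
log g 2≤g m k = record
  { Lower           = BelowLog
  ; Upper           = AboveLog
  ; lower-inhabited = lower-inhabited
  ; upper-inhabited = upper-inhabited
  ; lower-down      = λ {q} {r} → lower-down {q} {r}
  ; upper-up        = λ {q} {r} → upper-up {q} {r}
  ; lower-open      = lower-open
  ; upper-open      = upper-open
  ; disjoint        = <-asym
  ; located         = λ {q} {r} → located {q} {r}
  }
  where
  open Cut g m k
  open CutProperties 2≤g m k

-- Counts 0 ≤ n ≤ x; whether 0 is included does not affect the density.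
count : {A : Pred ℕ 0ℓ} → Decidable A → ℕ → ℕ
count A? x = length (filter A? (upTo (suc x)))

-- The limit is taken along integers x, which is equivalent to letting x
-- run through the reals.
HasNaturalDensity : {A : Pred ℕ 0ℓ} → Decidable A → ℝ → Set
HasNaturalDensity A? δ =
  ∀ (ε : ℚᵘ) → 0ℚᵘ ℚ.< ε →
  ∃ λ N → ∀ x .{{_ : NonZero x}} → N ≤ x → Within ε (+ count A? x ℚ./ x) δ

BeginsWith : (g D a : ℕ) → Set
BeginsWith g D a = ∃ λ j → D * g ^ j ≤ a × a < suc D * g ^ j

beginsWith? : ∀ {g} → 2 ≤ g → ∀ D .{{_ : NonZero D}} a → Dec (BeginsWith g D a)
beginsWith? {g} 2≤g D a = map′
  (λ (j , _ , p) → j , p)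
  (λ (j , lo , hi) → j ,
     s≤s (≤-trans (<⇒≤ (n<g^n 2≤g j)) (≤-trans (m≤n*m (g ^ j) D) lo)) , lo , hi)
  (anyUpTo? (λ j → (D * g ^ j ≤? a) ×-dec (a <? suc D * g ^ j)) (suc a))

-- The condition 2 ≤ n is there because a is only a sequence from index 2 on;
-- a 0 and a 1 are never used.
LeadingSet : (g D : ℕ) → (ℕ → ℕ) → Pred ℕ 0ℓ
LeadingSet g D a n = 2 ≤ n × BeginsWith g D (a n)

leadingSet? : ∀ {g} → 2 ≤ g → ∀ D .{{_ : NonZero D}} a → Decidable (LeadingSet g D a)
leadingSet? 2≤g D a n = (2 ≤? n) ×-dec beginsWith? 2≤g D (a n)

-- suc D / D = 1 + 1 / D.
IsBenford : (g : ℕ) → 2 ≤ g → (ℕ → ℕ) → Set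
IsBenford g 2≤g a =
  ∀ D .{{_ : NonZero D}} →
  HasNaturalDensity (leadingSet? 2≤g D a) (log g 2≤g (suc D) D)

s : ℕ → ℕ
s n = sum (filter (_∣? n) (upTo n))

{-# OPTIONS --safe #-}
module Submission where

-- The distribution of s(n) / n has infinite density just above 1/2.  Write
-- n = 2 r with r free of prime factors below k.  The divisors of n other than
-- n and r are at most n / k, so s(n) / n exceeds 1/2 by O(1/k) on average, while
-- such n have density ρ ≫ k^(-1/3).  Take D of order √k, and a window
-- [x, x + δ x] with x = 2 D g^j and δ of order 1 / D: most of these n in the window
-- satisfy D g^j ≤ s(n) < (D + 1) g^j, a proportion of order ρ.  Differencing
-- the counts at the two ends of the window, Benford behaviour would allow only a
-- proportion log_g (1 + 1/D) + o(1) = O(1/D), and ρ D is unbounded as k → ∞.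

import Data.Integer.Base as ℤ
import Data.Integer.Properties as ℤ
open import Data.List.Base using ([]; _∷_; _++_; filter; length; upTo)
import Data.List.Properties as List
open import Data.Nat.Base
open import Data.Nat.Coprimality using (Coprime; coprime-divisor)
open import Data.Nat.Divisibility
open import Data.Nat.DivMod using (_/_; m≡m%n+[m/n]*n; m%n<n; m/n*n≤m)
open import Data.Nat.ListAction using (sum)
open import Data.Nat.ListAction.Properties using (sum-++)
open import Data.Nat.Primality
open import Data.Nat.Properties
open import Data.Nat.Solver using (module +-*-Solver)
open import Data.Product.Base using (∃; _×_; _,_; proj₁; proj₂)
open import Data.Rational.Unnormalised.Base as ℚ using (0ℚᵘ; *<*)
import Data.Rational.Unnormalised.Properties as ℚ
open import Function.Base using (_∘_)
open import Level using (0ℓ)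
open import Relation.Binary.PropositionalEquality
open import Relation.Nullary.Decidable
  using (Dec; yes; no; map′; recompute; _×-dec_; ¬?)
open import Relation.Nullary.Negation using (¬_; contradiction)
open import Relation.Unary using (Pred; Decidable)
open import Defs

open +-*-Solver

-- Finite sums over initial segments of ℕ

∑ : ℕ → (ℕ → ℕ) → ℕ
∑ zero    f = 0
∑ (suc n) f = ∑ n f + f n

∑-mono : ∀ n {f g} → (∀ i → i < n → f i ≤ g i) → ∑ n f ≤ ∑ n g
∑-mono zero    f≤g = z≤n
∑-mono (suc n) f≤g =
  +-mono-≤ (∑-mono n (λ i i<n → f≤g i (m<n⇒m<1+n i<n))) (f≤g n ≤-refl)

∑-cong : ∀ n {f g} → (∀ i → f i ≡ g i) → ∑ n f ≡ ∑ n g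
∑-cong zero    f≡g = refl
∑-cong (suc n) f≡g = cong₂ _+_ (∑-cong n f≡g) (f≡g n)

∑-distrib-+ : ∀ n f g → ∑ n (λ i → f i + g i) ≡ ∑ n f + ∑ n g
∑-distrib-+ zero    f g = refl
∑-distrib-+ (suc n) f g rewrite ∑-distrib-+ n f g =
  solve 4 (λ x y z w → x :+ y :+ (z :+ w) := x :+ z :+ (y :+ w)) refl
    (∑ n f) (∑ n g) (f n) (g n)

∑-distribˡ-* : ∀ n c f → ∑ n (λ i → c * f i) ≡ c * ∑ n f
∑-distribˡ-* zero    c f = sym (*-zeroʳ c)
∑-distribˡ-* (suc n) c f rewrite ∑-distribˡ-* n c f =
  sym (*-distribˡ-+ c (∑ n f) (f n))

∑-zero : ∀ n {f} → (∀ i → i < n → f i ≡ 0) → ∑ n f ≡ 0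
∑-zero zero    f≡0 = refl
∑-zero (suc n) f≡0
  rewrite ∑-zero n (λ i i<n → f≡0 i (m<n⇒m<1+n i<n)) = f≡0 n ≤-refl

∑-≤-const : ∀ n {f c} → (∀ i → i < n → f i ≤ c) → ∑ n f ≤ n * c
∑-≤-const zero            f≤c = z≤n
∑-≤-const (suc n) {f} {c} f≤c = subst (∑ n f + f n ≤_) (+-comm (n * c) c)
  (+-mono-≤ (∑-≤-const n (λ i i<n → f≤c i (m<n⇒m<1+n i<n))) (f≤c n ≤-refl))

∑-split : ∀ m n f → ∑ (m + n) f ≡ ∑ m f + ∑ n (λ i → f (m + i))
∑-split m zero    f rewrite +-identityʳ m = sym (+-identityʳ _)
∑-split m (suc n) f rewrite +-suc m n | ∑-split m n f =
  +-assoc (∑ m f) _ _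

∑-swap : ∀ m n (f : ℕ → ℕ → ℕ) →
  ∑ m (λ i → ∑ n (f i)) ≡ ∑ n (λ j → ∑ m (λ i → f i j))
∑-swap zero    n f = sym (∑-zero n (λ _ _ → refl))
∑-swap (suc m) n f rewrite ∑-swap m n f = sym (∑-distrib-+ n _ (f m))

∑-monoˡ : ∀ {m n} f → m ≤ n → ∑ m f ≤ ∑ n f
∑-monoˡ {m} f m≤n with m≤n⇒∃[o]m+o≡n m≤n
... | o , refl rewrite ∑-split m o f = m≤m+n _ _

term≤∑ : ∀ {k n} f → k < n → f k ≤ ∑ n f
term≤∑ {k} f k<n = ≤-trans (m≤n+m (f k) (∑ k f)) (∑-monoˡ f k<n)

∑-double : ∀ n f → ∑ n (λ i → f (2 * i)) ≤ ∑ (2 * n) f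
∑-double zero    f = z≤n
∑-double (suc n) f rewrite +-suc n (n + 0) =
  ≤-trans (+-monoˡ-≤ (f (2 * n)) (∑-double n f)) (m≤m+n _ _)

-- Cut the range into `n` blocks of length `k`: only the first index of each block is a multiple of
-- `k`.
∑-multiples : ∀ k .{{_ : NonZero k}} n {f} → (∀ i → k ∤ i → f i ≡ 0) →
  ∑ (k * n) f ≡ ∑ n (λ i → f (k * i))
∑-multiples k zero    {f} f≡0 rewrite *-zeroʳ k = refl
∑-multiples k@(suc k-1) (suc n) {f} f≡0 = begin
  ∑ (k * suc n) f
    ≡⟨ cong (λ m → ∑ m f) (trans (*-suc k n) (+-comm k (k * n))) ⟩
  ∑ (k * n + (1 + k-1)) f
    ≡⟨ ∑-split (k * n) (1 + k-1) f ⟩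
  ∑ (k * n) f + ∑ (1 + k-1) (λ i → f (k * n + i))
    ≡⟨ cong₂ _+_ (∑-multiples k n f≡0) (∑-split 1 k-1 _) ⟩
  ∑ n (λ i → f (k * i)) + (f (k * n + 0) + ∑ k-1 (λ i → f (k * n + suc i)))
    ≡⟨ cong (∑ n (λ i → f (k * i)) +_) (cong₂ _+_ (cong f (+-identityʳ (k * n)))
         (∑-zero k-1 (λ i i<k-1 → f≡0 _ (λ k∣ →
           <⇒≱ (s≤s i<k-1) (∣⇒≤ (∣m+n∣m⇒∣n k∣ (m∣m*n n))))))) ⟩
  ∑ n (λ i → f (k * i)) + (f (k * n) + 0)
    ≡⟨ cong (∑ n (λ i → f (k * i)) +_) (+-identityʳ _) ⟩
  ∑ n (λ i → f (k * i)) + f (k * n) ∎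
  where open ≡-Reasoning

∑-vanishing : ∀ l n f → (∀ i → l ≤ i → i < n → f i ≡ 0) → ∑ n f ≤ ∑ l f
∑-vanishing l zero    f f≡0 = z≤n
∑-vanishing l (suc n) f f≡0 with l ≤? n
... | no  l≰n = ∑-monoˡ f (≰⇒> l≰n)
... | yes l≤n rewrite f≡0 n l≤n ≤-refl | +-identityʳ (∑ n f) =
  ∑-vanishing l n f (λ i l≤i i<n → f≡0 i l≤i (m<n⇒m<1+n i<n))

-- Meant for the divisors of `2 * r`, where `r` is the one survivor from `l` on. If `r` lies below
-- `l` it is counted twice, which is harmless in an upper bound.
∑-vanishing-except : ∀ l r n f → (∀ i → l ≤ i → i < n → i ≢ r → f i ≡ 0) →
  ∑ n f ≤ ∑ l f + f r
∑-vanishing-except l r zero    f f≡0 = z≤n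
∑-vanishing-except l r (suc n) f f≡0 with l ≤? n | n ≟ r
... | no  l≰n | _        = ≤-trans (∑-monoˡ f (≰⇒> l≰n)) (m≤m+n _ _)
... | yes l≤n | yes refl = +-monoˡ-≤ (f n) (∑-vanishing l n f
  (λ i l≤i i<n → f≡0 i l≤i (m<n⇒m<1+n i<n) (<⇒≢ i<n)))
... | yes l≤n | no  n≢r rewrite f≡0 n l≤n ≤-refl n≢r | +-identityʳ (∑ n f) =
  ∑-vanishing-except l r n f (λ i l≤i i<n → f≡0 i l≤i (m<n⇒m<1+n i<n))

-- Indicators and the counting of decidable sets

𝟙 : {A : Set} → Dec A → ℕ
𝟙 (yes _) = 1
𝟙 (no  _) = 0

module _ {A : Set} where

  𝟙-yes : (a? : Dec A) → A → 𝟙 a? ≡ 1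
  𝟙-yes (yes _) a = refl
  𝟙-yes (no ¬a) a = contradiction a ¬a

  𝟙-no : (a? : Dec A) → ¬ A → 𝟙 a? ≡ 0
  𝟙-no (yes a) ¬a = contradiction a ¬a
  𝟙-no (no _)  ¬a = refl

  𝟙-≤1 : (a? : Dec A) → 𝟙 a? ≤ 1
  𝟙-≤1 (yes _) = ≤-refl
  𝟙-≤1 (no _)  = z≤n

𝟙-cong : {A B : Set} (a? : Dec A) (b? : Dec B) → (A → B) → (B → A) → 𝟙 a? ≡ 𝟙 b?
𝟙-cong (yes a) b? to from = sym (𝟙-yes b? (to a))
𝟙-cong (no ¬a) b? to from = sym (𝟙-no b? (¬a ∘ from))

module _ {A : Pred ℕ 0ℓ} (A? : Decidable A) where

  filter-∷ʳ : ∀ n → filter A? (upTo (suc n)) ≡ filter A? (upTo n) ++ filter A? (n ∷ [])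
  filter-∷ʳ n = trans (cong (filter A?) (sym (List.upTo-∷ʳ n)))
    (List.filter-++ A? (upTo n) (n ∷ []))

  length-filter-upTo : ∀ n → length (filter A? (upTo n)) ≡ ∑ n (λ i → 𝟙 (A? i))
  length-filter-upTo zero    = refl
  length-filter-upTo (suc n) =
    trans (cong length (filter-∷ʳ n))
      (trans (List.length-++ (filter A? (upTo n)))
        (cong₂ _+_ (length-filter-upTo n) last))
    where
    last : length (filter A? (n ∷ [])) ≡ 𝟙 (A? n)
    last with A? n
    ... | yes _ = refl
    ... | no  _ = refl

  sum-filter-upTo : ∀ n → sum (filter A? (upTo n)) ≡ ∑ n (λ i → 𝟙 (A? i) * i)
  sum-filter-upTo zero    = refl
  sum-filter-upTo (suc n) =
    trans (cong sum (filter-∷ʳ n))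
      (trans (sum-++ (filter A? (upTo n)) (filter A? (n ∷ [])))
        (cong₂ _+_ (sum-filter-upTo n) last))
    where
    last : sum (filter A? (n ∷ [])) ≡ 𝟙 (A? n) * n
    last with A? n
    ... | yes _ = refl
    ... | no  _ = refl

𝟙-split : {A B : Set} (a? : Dec A) (b? : Dec B) →
  𝟙 a? ≡ 𝟙 (a? ×-dec ¬? b?) + 𝟙 (a? ×-dec b?)
𝟙-split (yes _) (yes _) = refl
𝟙-split (yes _) (no _)  = refl
𝟙-split (no _)  _       = refl

-- Densities of rough numbers

rough? : ∀ k → Decidable (k Rough_)
rough? k n = ¬? (map′ to from (anyUpTo? (λ d → nonTrivial? d ×-dec d ∣? n) k))
  where
  to : ∃ (λ d → d < k × NonTrivial d × d ∣ n) → n HasNonTrivialDivisorLessThan k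
  to (d , d<k , d>1 , d∣n) = hasNonTrivialDivisor {{nontrivial = d>1}} d<k d∣n

  from : n HasNonTrivialDivisorLessThan k → ∃ (λ d → d < k × NonTrivial d × d ∣ n)
  from (hasNonTrivialDivisor {d} {{d>1}} d<k d∣n) =
    -- The nontriviality of `d` is an irrelevant field; its decidability makes it available again.
    d , d<k , recompute (nonTrivial? d) d>1 , d∣n

-- A common divisor of at least 2 is at most `d`, so it would be a nontrivial divisor of `n` below
-- `k`.
rough⇒coprime : ∀ {k n d} .{{_ : NonZero d}} → k Rough n → d < k → Coprime d n
rough⇒coprime {k} {n} {d} rough d<k {zero}  (0∣d , _)     =
  contradiction (0∣⇒≡0 0∣d) (≢-nonZero⁻¹ d)
rough⇒coprime {k} {n} {d} rough d<k {1}     _             = refl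
rough⇒coprime {k} {n} {d} rough d<k {2+ c}  (c∣d , c∣n)   =
  contradiction (hasNonTrivialDivisor (≤-<-trans (∣⇒≤ c∣d) d<k) c∣n) rough

roughs : ℕ → ℕ → ℕ
roughs k r = 𝟙 (rough? k r)

-- The k-rough numbers have density a / Q.
record Sieves (k Q a : ℕ) : Set where
  constructor mkSieves
  field ∑-roughs : ∀ t → ∑ (Q * t) (roughs k) ≡ a * t

open Sieves

sieves-2 : Sieves 2 1 1
sieves-2 = mkSieves λ t → begin
  ∑ (1 * t) (roughs 2)     ≡⟨ ∑-cong (1 * t) (λ r → 𝟙-yes (rough? 2 r) 2-rough) ⟩
  ∑ (1 * t) (λ _ → 1)      ≡⟨ ∑-const (1 * t) ⟩
  1 * t                    ∎
  where
  open ≡-Reasoning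

  ∑-const : ∀ n → ∑ n (λ _ → 1) ≡ n
  ∑-const zero    = refl
  ∑-const (suc n) = trans (cong (_+ 1) (∑-const n)) (+-comm n 1)

-- A `k`-rough number divisible by `k` forces `k` to be prime, so for composite `k` nothing is
-- removed.
sieves-composite : ∀ {k Q a} .{{_ : NonTrivial k}} → ¬ Prime k →
  Sieves k Q a → Sieves (suc k) Q a
sieves-composite {k} {Q} ¬p sieves = mkSieves λ t → trans
  (∑-cong (Q * t) (λ r → 𝟙-cong (rough? (suc k) r) (rough? k r)
    (λ rough (hasNonTrivialDivisor d<k d∣r) →
      rough (hasNonTrivialDivisor (m<n⇒m<1+n d<k) d∣r))
    (λ rough → ∤⇒rough-suc (¬p ∘ rough∧∣⇒prime rough) rough)))
  (∑-roughs sieves t)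

-- The numbers removed are the `k`-rough multiples of `k = suc p`. By primality these are `k` times
-- the `k`-rough numbers, one `k`-th of them all, so a factor `p / k` remains. Their count `a * t`
-- is added to both sides to avoid subtraction.
sieves-prime : ∀ {p Q a} → Prime (suc p) → Sieves (suc p) Q a →
  Sieves (2 + p) (suc p * Q) (p * a)
sieves-prime {p} {Q} {a} isPrime sieves = mkSieves λ t → +-cancelʳ-≡ (a * t) _ _ (begin
  ∑ (k * Q * t) (roughs (suc k)) + a * t
    ≡⟨ cong (∑ (k * Q * t) (roughs (suc k)) +_) (multiples t) ⟨
  ∑ (k * Q * t) (roughs (suc k)) + ∑ (k * Q * t) (λ r → 𝟙 (rough? k r ×-dec k ∣? r))
    ≡⟨ ∑-distrib-+ (k * Q * t) _ _ ⟨
  ∑ (k * Q * t) (λ r → roughs (suc k) r + 𝟙 (rough? k r ×-dec k ∣? r))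
    ≡⟨ ∑-cong (k * Q * t) split ⟨
  ∑ (k * Q * t) (roughs k)
    ≡⟨ cong (λ m → ∑ m (roughs k)) (solve 3 (λ k Q t →
         k :* Q :* t := Q :* (k :* t)) refl k Q t) ⟩
  ∑ (Q * (k * t)) (roughs k)
    ≡⟨ ∑-roughs sieves (k * t) ⟩
  a * (k * t)
    ≡⟨ solve 3 (λ a p t → a :* ((con 1 :+ p) :* t) := p :* a :* t :+ a :* t)
         refl a p t ⟩
  p * a * t + a * t ∎)
  where
  open ≡-Reasoning
  k = suc p

  split : ∀ r → roughs k r ≡ roughs (suc k) r + 𝟙 (rough? k r ×-dec k ∣? r)
  split r = trans (𝟙-split (rough? k r) (k ∣? r)) (cong (_+ 𝟙 (rough? k r ×-dec k ∣? r))
    (𝟙-cong (rough? k r ×-dec ¬? (k ∣? r)) (rough? (suc k) r)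
      (λ (rough , k∤r) → ∤⇒rough-suc k∤r rough)
      (λ rough →
        (λ (hasNonTrivialDivisor d<k d∣r) →
          rough (hasNonTrivialDivisor (m<n⇒m<1+n d<k) d∣r)) ,
        (λ k∣r → rough (hasNonTrivialDivisor {{nontrivial = prime⇒nonTrivial isPrime}}
          ≤-refl k∣r)))))

  rough-* : ∀ r → k Rough r → k Rough (k * r)
  rough-* r rough (hasNonTrivialDivisor {d} {{d>1}} d<k d∣kr) =
    -- The prime `k` is coprime to `d < k`, so `d ∣ k * r` gives `d ∣ r`.
    rough (hasNonTrivialDivisor d<k (coprime-divisor
      (rough⇒coprime {{nonTrivial⇒nonZero d}} (prime⇒rough isPrime) d<k) d∣kr))

  multiples : ∀ t → ∑ (k * Q * t) (λ r → 𝟙 (rough? k r ×-dec k ∣? r)) ≡ a * t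
  multiples t = begin
    ∑ (k * Q * t) (λ r → 𝟙 (rough? k r ×-dec k ∣? r))
      ≡⟨ cong (λ m → ∑ m (λ r → 𝟙 (rough? k r ×-dec k ∣? r))) (*-assoc k Q t) ⟩
    ∑ (k * (Q * t)) (λ r → 𝟙 (rough? k r ×-dec k ∣? r))
      ≡⟨ ∑-multiples k (Q * t) (λ r k∤r →
           𝟙-no (rough? k r ×-dec k ∣? r) (k∤r ∘ proj₂)) ⟩
    ∑ (Q * t) (λ r → 𝟙 (rough? k (k * r) ×-dec k ∣? (k * r)))
      ≡⟨ ∑-cong (Q * t) (λ r → 𝟙-cong (rough? k (k * r) ×-dec k ∣? (k * r)) (rough? k r)
           (λ (rough , _) → rough∧∣⇒rough rough (n∣m*n k))
           (λ rough → rough-* r rough , m∣m*n r)) ⟩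
    ∑ (Q * t) (roughs k)
      ≡⟨ ∑-roughs sieves t ⟩
    a * t ∎

-- In the composite case the modulus is inflated by `suc p` all the same, so that it does not depend
-- on a primality test; the price is a mere lower bound for the residue count.
sieves-suc : ∀ {p Q a} .{{_ : NonTrivial (suc p)}} → Sieves (suc p) Q a →
  ∃ λ a′ → Sieves (2 + p) (suc p * Q) a′ × p * a ≤ a′
sieves-suc {p} {Q} {a} sieves with prime? (suc p)
... | yes isPrime = p * a , sieves-prime isPrime sieves , ≤-refl
... | no  ¬prime  = suc p * a , scaled , m≤n+m (p * a) a
  where
  scaled : Sieves (2 + p) (suc p * Q) (suc p * a)
  scaled = mkSieves λ t → begin
    ∑ (suc p * Q * t) (roughs (2 + p))
      ≡⟨ cong (λ m → ∑ m (roughs (2 + p))) (rearrange (suc p) Q t) ⟩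
    ∑ (Q * (suc p * t)) (roughs (2 + p))
      ≡⟨ ∑-roughs (sieves-composite ¬prime sieves) (suc p * t) ⟩
    a * (suc p * t)
      ≡⟨ rearrange (suc p) a t ⟨
    suc p * a * t ∎
    where
    open ≡-Reasoning
    rearrange : ∀ k Q t → k * Q * t ≡ Q * (k * t)
    rearrange = solve 3 (λ k Q t → k :* Q :* t := Q :* (k :* t)) refl

¬prime[m*n] : ∀ m n .{{_ : NonTrivial m}} .{{_ : NonTrivial n}} → ¬ Prime (m * n)
¬prime[m*n] m n isPrime =
  prime⇒¬composite isPrime (hasNonTrivialDivisor {divisor = m}
    (m<m*n m n {{nonTrivial⇒nonZero m}} (nonTrivial⇒n>1 n)) (m∣m*n n))


-- Of the six candidates from `5 + 6 * i` on, all but `5 + 6 * i` and `7 + 6 * i` are proper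
-- multiples of 2 or 3, so only these two cost a factor.
sieves-6 : ∀ i {Q a} → Sieves (5 + 6 * i) Q a →
  ∃ λ a′ → Sieves (5 + 6 * suc i) ((7 + 6 * i) * ((5 + 6 * i) * Q)) a′ ×
           (6 + 6 * i) * ((4 + 6 * i) * a) ≤ a′
sieves-6 i {Q} {a} sieves with sieves-suc sieves
... | a₁ , sieves₁ , a≤a₁ with sieves-suc (sieves-composite ¬prime₆ sieves₁)
  where
  ¬prime₆ : ¬ Prime (6 + 6 * i)
  ¬prime₆ = subst (¬_ ∘ Prime) (solve 1 (λ i →
    con 2 :* (con 3 :+ con 3 :* i) := con 6 :+ con 6 :* i) refl i)
    (¬prime[m*n] 2 (3 + 3 * i))
... | a₂ , sieves₂ , a₁≤a₂ = a₂ ,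
  subst (λ k → Sieves k ((7 + 6 * i) * ((5 + 6 * i) * Q)) a₂)
    (solve 1 (λ i → con 11 :+ con 6 :* i := con 5 :+ con 6 :* (con 1 :+ i)) refl i)
    (sieves-composite ¬prime₁₀ (sieves-composite ¬prime₉
      (sieves-composite ¬prime₈ sieves₂))) ,
  ≤-trans (*-monoʳ-≤ (6 + 6 * i) a≤a₁) a₁≤a₂
  where
  ¬prime₈ : ¬ Prime (8 + 6 * i)
  ¬prime₈ = subst (¬_ ∘ Prime) (solve 1 (λ i →
    con 2 :* (con 4 :+ con 3 :* i) := con 8 :+ con 6 :* i) refl i)
    (¬prime[m*n] 2 (4 + 3 * i))

  ¬prime₉ : ¬ Prime (9 + 6 * i)
  ¬prime₉ = subst (¬_ ∘ Prime) (solve 1 (λ i →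
    con 3 :* (con 3 :+ con 2 :* i) := con 9 :+ con 6 :* i) refl i)
    (¬prime[m*n] 3 (3 + 2 * i))

  ¬prime₁₀ : ¬ Prime (10 + 6 * i)
  ¬prime₁₀ = subst (¬_ ∘ Prime) (solve 1 (λ i →
    con 2 :* (con 5 :+ con 3 :* i) := con 10 :+ con 6 :* i) refl i)
    (¬prime[m*n] 2 (5 + 3 * i))

-- With `z = suc i` the products are `36 z² - 1` and `12 z (3 z - 1)`. One turn thus lowers the
-- density by a factor below `3 z / (3 z - 1)`, whose cube is at most `z / i` for `i > 0`. These
-- quotients telescope, which is the source of the exponent 1/3.
wheel-≤ : ∀ i → ((5 + 6 * i) * (7 + 6 * i)) ^ 3 * i ≤
                ((4 + 6 * i) * (6 + 6 * i)) ^ 3 * suc i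
wheel-≤ i = begin
  ((5 + 6 * i) * (7 + 6 * i)) ^ 3 * i
    ≤⟨ *-monoˡ-≤ i (^-monoˡ-≤ 3 (≤-trans (n≤1+n _) (≤-reflexive (solve 1 (λ i →
         con 1 :+ (con 5 :+ con 6 :* i) :* (con 7 :+ con 6 :* i)
           := con 3 :* (con 1 :+ i) :* (con 12 :* (con 1 :+ i))) refl i)))) ⟩
  (3 * z * c) ^ 3 * i
    ≡⟨ solve 3 (λ z c i → (con 3 :* z :* c) :^ 3 :* i
         := c :^ 3 :* z :* (con 27 :* z :* z :* i)) refl z c i ⟩
  c ^ 3 * z * (27 * z * z * i)
    ≤⟨ *-monoʳ-≤ (c ^ 3 * z) (≤-trans (m≤m+n _ (9 * i + 8)) (≤-reflexive (solve 1 (λ i →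
         con 27 :* (con 1 :+ i) :* (con 1 :+ i) :* i :+ (con 9 :* i :+ con 8)
           := (con 2 :+ con 3 :* i) :^ 3) refl i))) ⟩
  c ^ 3 * z * (2 + 3 * i) ^ 3
    ≡⟨ solve 3 (λ c z x → c :^ 3 :* z :* x :^ 3 := (x :* c) :^ 3 :* z) refl
         c z (2 + 3 * i) ⟩
  ((2 + 3 * i) * c) ^ 3 * z
    ≡⟨ cong (λ x → x ^ 3 * z) (solve 1 (λ i → (con 2 :+ con 3 :* i) :* (con 12 :* (con 1 :+ i))
         := (con 4 :+ con 6 :* i) :* (con 6 :+ con 6 :* i)) refl i) ⟩
  ((4 + 6 * i) * (6 + 6 * i)) ^ 3 * z ∎
  where
  open ≤-Reasoning
  z = suc i; c = 12 * z

wheel-step : ∀ c i j u v u′ v′ Q a a′ →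
  (u * v) ^ 3 * i ≤ (u′ * v′) ^ 3 * j → v′ * (u′ * a) ≤ a′ →
  Q ^ 3 ≤ c * i * a ^ 3 → (v * (u * Q)) ^ 3 ≤ c * j * a′ ^ 3
wheel-step c i j u v u′ v′ Q a a′ uv≤ a≤ Q³≤ = begin
  (v * (u * Q)) ^ 3
    ≡⟨ solve 3 (λ u v Q → (v :* (u :* Q)) :^ 3 := (u :* v) :^ 3 :* Q :^ 3) refl u v Q ⟩
  (u * v) ^ 3 * Q ^ 3
    ≤⟨ *-monoʳ-≤ ((u * v) ^ 3) Q³≤ ⟩
  (u * v) ^ 3 * (c * i * a ^ 3)
    ≡⟨ solve 4 (λ x c y z → x :* (c :* y :* z) := c :* (x :* y) :* z) refl
         ((u * v) ^ 3) c i (a ^ 3) ⟩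
  c * ((u * v) ^ 3 * i) * a ^ 3
    ≤⟨ *-monoˡ-≤ (a ^ 3) (*-monoʳ-≤ c uv≤) ⟩
  c * ((u′ * v′) ^ 3 * j) * a ^ 3
    ≡⟨ solve 5 (λ u′ v′ c y a → c :* ((u′ :* v′) :^ 3 :* y) :* a :^ 3
         := c :* y :* (v′ :* (u′ :* a)) :^ 3) refl u′ v′ c j a ⟩
  c * j * (v′ * (u′ * a)) ^ 3
    ≤⟨ *-monoʳ-≤ (c * j) (^-monoˡ-≤ 3 a≤) ⟩
  c * j * a′ ^ 3 ∎
  where open ≤-Reasoning

-- Only numbers ≡ ±1 mod 6 can be primes to sieve by, so the density of the
-- k-rough numbers stays above a constant times k^(-1/3).
record Wheel (k c : ℕ) : Set where
  field
    modulus residues : ℕ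
    modulus≢0        : NonZero modulus
    sieves           : Sieves k modulus residues
    dense            : modulus ^ 3 ≤ c * residues ^ 3

wheel : ∀ i → Wheel (5 + 6 * suc i) (84 * suc i)
wheel zero = record
  { modulus  = 210
  ; residues = proj₁ mod210
  ; sieves   = proj₁ (proj₂ mod210)
  -- Sieving by 2, 3, 5 and 7 leaves at least `48 = 1 * 2 * 4 * 6` residues modulo 210, and 84 is
  -- the least `c` with `210 ^ 3 ≤ c * 48 ^ 3`.
  ; dense    = ≤-trans (≤ᵇ⇒≤ (210 ^ 3) (84 * 1 * 48 ^ 3) _)
      (*-monoʳ-≤ (84 * 1) (^-monoˡ-≤ 3 (≤-trans (*-monoʳ-≤ 6 (*-monoʳ-≤ 4
        (≤-trans (*-monoʳ-≤ 2 (proj₂ (proj₂ mod2))) (proj₂ (proj₂ mod6)))))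
        (proj₂ (proj₂ mod210)))))
  }
  where
  mod2   = sieves-suc sieves-2
  mod6   = sieves-suc (proj₁ (proj₂ mod2))
  mod210 = sieves-6 0 (sieves-composite (¬prime[m*n] 2 2) (proj₁ (proj₂ mod6)))
wheel (suc j) = record
  { modulus   = v * (u * modulus)
  ; residues  = proj₁ next
  ; modulus≢0 = m*n≢0 v (u * modulus) {{_}} {{m*n≢0 u modulus {{_}} {{modulus≢0}}}}
  ; sieves    = proj₁ (proj₂ next)
  ; dense     = wheel-step 84 i (suc i) u v u′ v′ modulus residues (proj₁ next)
      (wheel-≤ i) (proj₂ (proj₂ next)) dense
  }
  where
  open Wheel (wheel j)
  i = suc j
  u = 5 + 6 * i; v = 7 + 6 * i; u′ = 4 + 6 * i; v′ = 6 + 6 * i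
  next = sieves-6 i sieves

-- Sums of small divisors over windows

multiplesBelow : ℕ → ℕ → ℕ
multiplesBelow t n = ∑ n (λ i → 𝟙 (t ∣? i))

-- Since 0 counts as a multiple, `multiplesBelow t n` is `n / t` rounded up; the two bounds express
-- this without division.
multiplesBelow-bounds : ∀ t .{{_ : NonZero t}} n →
  n ≤ t * multiplesBelow t n × t * multiplesBelow t n < n + t
multiplesBelow-bounds t zero rewrite *-zeroʳ t = z≤n , >-nonZero⁻¹ t
multiplesBelow-bounds t (suc n) with t ∣? n | multiplesBelow-bounds t n
... | no  t∤n | lo , hi rewrite +-identityʳ (multiplesBelow t n) =
  ≤∧≢⇒< lo (λ n≡ → t∤n (subst (t ∣_) (sym n≡) (m∣m*n _))) , m<n⇒m<1+n hi
... | yes (divides q n≡qt) | lo , hi =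
  subst (n <_) (sym step) (m<m+n n (>-nonZero⁻¹ t)) ,
  ≤-reflexive (cong suc step)
  where
  M = multiplesBelow t n

  n≡tq : n ≡ t * q
  n≡tq = trans n≡qt (*-comm q t)

  -- When `n = t * q`, the bounds already known for `n` leave only this value.
  M≡q : M ≡ q
  M≡q = ≤-antisym
    (m<1+n⇒m≤n (*-cancelˡ-< t M (suc q) (subst (t * M <_)
      (trans (cong (_+ t) n≡tq) (trans (+-comm (t * q) t) (sym (*-suc t q)))) hi)))
    (*-cancelˡ-≤ t (subst (_≤ t * M) n≡tq lo))

  step : t * (M + 1) ≡ n + t
  step = trans (cong (λ m → t * (m + 1)) M≡q)
    (trans (cong (t *_) (+-comm q 1)) (trans (*-suc t q)
      (trans (+-comm t (t * q)) (cong (_+ t) (sym n≡tq)))))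

-- For `t > 0` the multiples in the window number a difference of two rounded-up quotients; for
-- `t = 0` all terms carry weight 0.
∑-multiples-in-window : ∀ t x h → ∑ h (λ i → 𝟙 (t ∣? (x + i)) * t) ≤ h + t
∑-multiples-in-window zero x h rewrite
  ∑-zero h (λ i _ → *-zeroʳ (𝟙 (0 ∣? (x + i)))) = z≤n
∑-multiples-in-window t@(suc _) x h = +-cancelˡ-≤ x _ _ (begin
  x + ∑ h (λ i → 𝟙 (t ∣? (x + i)) * t)
    ≤⟨ +-monoˡ-≤ _ (proj₁ (multiplesBelow-bounds t x)) ⟩
  t * multiplesBelow t x + ∑ h (λ i → 𝟙 (t ∣? (x + i)) * t)
    ≡⟨ cong (t * multiplesBelow t x +_) (trans
         (∑-cong h (λ i → *-comm (𝟙 (t ∣? (x + i))) t)) (∑-distribˡ-* h t _)) ⟩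
  t * multiplesBelow t x + t * ∑ h (λ i → 𝟙 (t ∣? (x + i)))
    ≡⟨ *-distribˡ-+ t (multiplesBelow t x) _ ⟨
  t * (multiplesBelow t x + ∑ h (λ i → 𝟙 (t ∣? (x + i))))
    ≡⟨ cong (t *_) (∑-split x h (λ i → 𝟙 (t ∣? i))) ⟨
  t * multiplesBelow t (x + h)
    ≤⟨ <⇒≤ (proj₂ (multiplesBelow-bounds t (x + h))) ⟩
  x + h + t
    ≡⟨ +-assoc x h t ⟩
  x + (h + t) ∎)
  where open ≤-Reasoning

smallDivisorSum : ℕ → ℕ → ℕ
smallDivisorSum l n = ∑ l (λ t → 𝟙 (t ∣? n) * t)

-- Exchanging the sums, each `t < l` contributes at most `h + t`. In a long window the divisors
-- below `l` therefore add up to not much more than `l` on average.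
∑-smallDivisorSum : ∀ l x h → ∑ h (λ i → smallDivisorSum l (x + i)) ≤ l * (h + l)
∑-smallDivisorSum l x h = begin
  ∑ h (λ i → smallDivisorSum l (x + i))
    ≡⟨ ∑-swap h l (λ i t → 𝟙 (t ∣? (x + i)) * t) ⟩
  ∑ l (λ t → ∑ h (λ i → 𝟙 (t ∣? (x + i)) * t))
    ≤⟨ ∑-≤-const l (λ t t<l → ≤-trans (∑-multiples-in-window t x h)
         (+-monoʳ-≤ h (<⇒≤ t<l))) ⟩
  l * (h + l) ∎
  where open ≤-Reasoning

-- The value of s at twice a rough number

s≡smallDivisorSum : ∀ n → s n ≡ smallDivisorSum n n
s≡smallDivisorSum n = sum-filter-upTo (_∣? n) n

r≤s[2r] : ∀ r .{{_ : NonZero r}} → r ≤ s (2 * r)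
r≤s[2r] r rewrite s≡smallDivisorSum (2 * r) = begin
  r                          ≡⟨ *-identityˡ r ⟨
  1 * r                      ≡⟨ cong (_* r) (𝟙-yes (r ∣? (2 * r)) (n∣m*n 2)) ⟨
  𝟙 (r ∣? (2 * r)) * r       ≤⟨ term≤∑ (λ t → 𝟙 (t ∣? (2 * r)) * t) (m<m+n r (subst (0 <_) (sym (+-identityʳ r)) (>-nonZero⁻¹ r))) ⟩
  smallDivisorSum (2 * r) (2 * r) ∎
  where open ≤-Reasoning

-- A cofactor e < k of d would be coprime to the k-rough r, hence divide 2.
rough⇒divisor-bound : ∀ {k r} .{{_ : NonZero r}} → k Rough r →
  ∀ {d} → d ∣ 2 * r → d < 2 * r → d ≢ r → k * d ≤ 2 * r
rough⇒divisor-bound {k} {r} rough {d} (divides e 2r≡ed) d<2r d≢r with e <? k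
... | no e≮k = subst (k * d ≤_) (sym 2r≡ed) (*-monoˡ-≤ d (≮⇒≥ e≮k))
... | yes e<k with e
...   | 0 = contradiction (m+n≡0⇒m≡0 r 2r≡ed) (≢-nonZero⁻¹ r)
...   | 1 = contradiction (trans (sym (*-identityˡ d)) (sym 2r≡ed)) (<⇒≢ d<2r)
...   | 2 = contradiction (sym (*-cancelˡ-≡ r d 2 2r≡ed)) d≢r
...   | e@(suc (suc (suc _))) = contradiction
  (∣⇒≤ (coprime-divisor (rough⇒coprime rough e<k) (divides d (trans
    (*-comm r 2) (trans 2r≡ed (*-comm e d)))))) (<⇒≱ (s≤s (s≤s (s≤s z≤n))))

-- A proper divisor `d ≥ l` other than `r` would have `k * d ≥ k * l > 2 * r`, against
-- `rough⇒divisor-bound`.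
s[2r]≤ : ∀ {k r l} .{{_ : NonZero r}} → k Rough r → 2 * r < k * l →
  s (2 * r) ≤ smallDivisorSum l (2 * r) + r
s[2r]≤ {k} {r} {l} rough 2r<kl rewrite s≡smallDivisorSum (2 * r) = begin
  smallDivisorSum (2 * r) (2 * r)
    ≤⟨ ∑-vanishing-except l r (2 * r) _ (λ d l≤d d<2r d≢r →
         cong (_* d) (𝟙-no (d ∣? (2 * r)) (λ d∣2r → <⇒≱ 2r<kl (≤-trans
           (*-monoʳ-≤ k l≤d) (rough⇒divisor-bound rough d∣2r d<2r d≢r))))) ⟩
  smallDivisorSum l (2 * r) + 𝟙 (r ∣? (2 * r)) * r
    ≤⟨ +-monoʳ-≤ (smallDivisorSum l (2 * r)) (*-monoˡ-≤ r (𝟙-≤1 (r ∣? (2 * r)))) ⟩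
  smallDivisorSum l (2 * r) + 1 * r
    ≡⟨ cong (smallDivisorSum l (2 * r) +_) (*-identityˡ r) ⟩
  smallDivisorSum l (2 * r) + r ∎
  where open ≤-Reasoning

-- An upper bound for the logarithm of 1 + 1/D

-- This is `(1 - 1/c) ^ n ≥ 1 - n/c` for `c = suc d`, multiplied by `c ^ suc n`.
bernoulli : ∀ d n → suc d ^ n * suc d ≤ suc d * d ^ n + n * suc d ^ n
bernoulli d zero    = ≤-reflexive (solve 1 (λ d →
  con 1 :* (con 1 :+ d) := (con 1 :+ d) :* con 1 :+ con 0) refl d)
bernoulli d (suc n) = begin
  c * c ^ n * c
    ≡⟨ *-assoc c (c ^ n) c ⟩
  c * (c ^ n * c)
    ≤⟨ *-monoʳ-≤ c (bernoulli d n) ⟩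
  c * (c * d ^ n + n * c ^ n)
    ≡⟨ solve 4 (λ d x n y → (con 1 :+ d) :* ((con 1 :+ d) :* x :+ n :* y)
         := (con 1 :+ d) :* (d :* x) :+ (n :* ((con 1 :+ d) :* y) :+ (con 1 :+ d) :* x))
         refl d (d ^ n) n (c ^ n) ⟩
  c * (d * d ^ n) + (n * (c * c ^ n) + c * d ^ n)
    ≤⟨ +-monoʳ-≤ (c * (d * d ^ n)) (+-monoʳ-≤ (n * (c * c ^ n))
         (*-monoʳ-≤ c (^-monoˡ-≤ n (n≤1+n d)))) ⟩
  c * (d * d ^ n) + (n * (c * c ^ n) + c * c ^ n)
    ≡⟨ cong (c * (d * d ^ n) +_) (+-comm (n * (c * c ^ n)) (c * c ^ n)) ⟩
  c * d ^ suc n + suc n * c ^ suc n ∎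
  where
  open ≤-Reasoning
  c = suc d

-- Bernoulli's inequality with `c = 2m + 1` and `n = m` gives
-- `(2m / c) ^ m ≥ (m + 1) / (2m + 1) > 1/2`.
[1+2m]^m<2*[2m]^m : ∀ m .{{_ : NonZero m}} → suc (2 * m) ^ m < 2 * (2 * m) ^ m
[1+2m]^m<2*[2m]^m m = *-cancelʳ-< (suc m) _ _ (+-cancelʳ-< (m * c ^ m) _ _ (begin-strict
  c ^ m * suc m + m * c ^ m
    ≡⟨ solve 2 (λ x m → x :* (con 1 :+ m) :+ m :* x := x :* (con 1 :+ con 2 :* m))
         refl (c ^ m) m ⟩
  c ^ m * c
    ≤⟨ bernoulli (2 * m) m ⟩
  c * (2 * m) ^ m + m * c ^ m
    <⟨ +-monoˡ-< (m * c ^ m) (m<n+m _ (m^n>0 (2 * m) {{m*n≢0 2 m}} m)) ⟩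
  (2 * m) ^ m + c * (2 * m) ^ m + m * c ^ m
    ≡⟨ cong (_+ m * c ^ m) (solve 2 (λ x m → x :+ (con 1 :+ con 2 :* m) :* x
         := con 2 :* x :* (con 1 :+ m)) refl ((2 * m) ^ m) m) ⟩
  2 * (2 * m) ^ m * suc m + m * c ^ m ∎))
  where
  open ≤-Reasoning
  c = suc (2 * m)

-- At `1 / m` the upper cut unfolds to `(1 + 1/2m) ^ m < g`. For `D = 2 * m` the Benford density is
-- thus below `2 / D`.
log[1+1/2m]<1/m : ∀ {g} (2≤g : 2 ≤ g) m .{{_ : NonZero m}} .{{_ : NonZero (2 * m)}} →
  ℝ.Upper (log g 2≤g (suc (2 * m)) (2 * m)) (ℤ.+ 1 ℚ./ m)
log[1+1/2m]<1/m {g} 2≤g m@(suc _) = begin-strict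
  suc (2 * m) ^ m * 1      ≡⟨ *-identityʳ _ ⟩
  suc (2 * m) ^ m          <⟨ [1+2m]^m<2*[2m]^m m ⟩
  2 * (2 * m) ^ m          ≤⟨ *-monoˡ-≤ ((2 * m) ^ m) 2≤g ⟩
  g * (2 * m) ^ m          ≡⟨ cong (_* (2 * m) ^ m) (*-identityʳ g) ⟨
  g * 1 * (2 * m) ^ m      ∎
  where open ≤-Reasoning

-- From natural density to counts in windows

lower<upper : ∀ x {q r} → ℝ.Lower x q → ℝ.Upper x r → q ℚ.< r
lower<upper x {q} {r} q<x x<r with q ℚ.<? r
... | yes q<r = q<r
... | no  q≮r = contradiction x<r (ℝ.disjoint x (ℝ.lower-down x (ℚ.≮⇒≥ q≮r) q<x))

p-q<r⇒p<r+q : ∀ {p q r} → p ℚ.- q ℚ.< r → p ℚ.< r ℚ.+ q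
p-q<r⇒p<r+q {p} {q} {r} p-q<r = begin-strict
  p                     ≃⟨ ℚ.+-identityʳ p ⟨
  p ℚ.+ 0ℚᵘ             ≃⟨ ℚ.+-congʳ p (ℚ.+-inverseˡ q) ⟨
  p ℚ.+ (ℚ.- q ℚ.+ q)   ≃⟨ ℚ.+-assoc p (ℚ.- q) q ⟨
  p ℚ.- q ℚ.+ q         <⟨ ℚ.+-monoˡ-< q p-q<r ⟩
  r ℚ.+ q               ∎
  where open ℚ.≤-Reasoning

+-fractions : ∀ a b c d .{{_ : NonZero b}} .{{_ : NonZero d}} →
  (ℤ.+ a ℚ./ b) ℚ.+ (ℤ.+ c ℚ./ d) ≡ (ℤ.+ (a * d + c * b) ℚ./ (b * d)) {{m*n≢0 b d}}
+-fractions a b@(suc _) c d@(suc _) = cong (ℚ._/ (b * d)) (sym (trans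
  (ℤ.pos-+ (a * d) (c * b)) (cong₂ ℤ._+_ (ℤ.pos-* a d) (ℤ.pos-* c b))))

fraction-<⁻¹ : ∀ a b c d .{{_ : NonZero b}} .{{_ : NonZero d}} →
  ℤ.+ a ℚ./ b ℚ.< ℤ.+ c ℚ./ d → a * d < c * b
fraction-<⁻¹ a b@(suc _) c d@(suc _) (*<* p) =
  ℤ.drop‿+<+ (subst₂ ℤ._<_ (sym (ℤ.pos-* a d)) (sym (ℤ.pos-* c b)) p)

module _ {A : Pred ℕ 0ℓ} (A? : Decidable A) where

  members : ℕ → ℕ
  members i = 𝟙 (A? i)

  ∑≤count : ∀ x → ∑ x members ≤ count A? x
  ∑≤count x rewrite length-filter-upTo A? (suc x) = m≤m+n _ _

  count≤1+∑ : ∀ x → count A? x ≤ 1 + ∑ x members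
  count≤1+∑ x rewrite length-filter-upTo A? (suc x) | +-comm 1 (∑ x members) =
    +-monoʳ-≤ (∑ x members) (𝟙-≤1 (A? x))

  -- Let `y = x + h`, with counts `c₁` up to `x` and `c₂` up to `y`. Tolerance `1 / E` yields
  -- `c₂ / y < 1/m + 1/E` and `c₂ / y < c₁ / x + 2/E`. Splitting `c₂` as `(c₂ / y) x + (c₂ / y) h`
  -- bounds `c₂ - c₁` by `2x/E + h (1/m + 1/E)`. The claim is this times `m * E`, with one more
  -- `m * E` for an endpoint.
  density⇒window : ∀ δ → HasNaturalDensity A? δ →
    ∀ m E .{{_ : NonZero m}} .{{_ : NonZero E}} → ℝ.Upper δ (ℤ.+ 1 ℚ./ m) →
    ∃ λ N → ∀ x h .{{_ : NonZero x}} → N ≤ x →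
    m * E * ∑ h (λ i → members (x + i)) ≤ h * (E + m) + 2 * m * x + m * E
  density⇒window δ density m E@(suc _) δ<1/m
    with density (ℤ.+ 1 ℚ./ E) (*<* (ℤ.+<+ z<s))
  ... | N , within = N , bound
    where
    bound : ∀ x h .{{_ : NonZero x}} → N ≤ x →
      m * E * ∑ h (λ i → members (x + i)) ≤ h * (E + m) + 2 * m * x + m * E
    bound x@(suc _) h N≤x = *-cancelʳ-≤ _ _ y (+-cancelˡ-≤ (m * E * c₁ * y) _ _ (begin
      m * E * c₁ * y + m * E * W * y
        ≡⟨ solve 4 (λ e c y w → e :* c :* y :+ e :* w :* y := e :* (c :+ w) :* y) refl
             (m * E) c₁ y W ⟩
      m * E * (c₁ + W) * y
        ≤⟨ *-monoˡ-≤ y (*-monoʳ-≤ (m * E) increment) ⟩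
      m * E * (1 + c₂) * y
        ≡⟨ solve 5 (λ m E c x h → m :* E :* (con 1 :+ c) :* (x :+ h) :=
             m :* (c :* x :* E) :+ c :* m :* E :* h :+ m :* E :* (x :+ h)) refl
             m E c₂ x h ⟩
      m * (c₂ * x * E) + c₂ * m * E * h + m * E * y
        ≤⟨ +-monoˡ-≤ (m * E * y) (+-mono-≤ (*-monoʳ-≤ m almost-constant)
             (*-monoˡ-≤ h density-bound)) ⟩
      m * ((c₁ * E + 2 * x) * y) + (E + m) * y * h + m * E * y
        ≡⟨ solve 6 (λ m E c x h y →
             m :* ((c :* E :+ con 2 :* x) :* y) :+ (E :+ m) :* y :* h :+ m :* E :* y :=
             m :* E :* c :* y :+ (h :* (E :+ m) :+ con 2 :* m :* x :+ m :* E) :* y) refl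
             m E c₁ x h y ⟩
      m * E * c₁ * y + (h * (E + m) + 2 * m * x + m * E) * y ∎))
      where
      open ≤-Reasoning
      y = x + h
      c₁ = count A? x
      c₂ = count A? y
      W = ∑ h (λ i → members (x + i))

      -- `count` includes the index `x` itself while `∑ x` stops before it, hence the 1.
      increment : c₁ + W ≤ 1 + c₂
      increment = begin
        c₁ + W                    ≤⟨ +-monoˡ-≤ W (count≤1+∑ x) ⟩
        1 + (∑ x members + W)     ≡⟨ cong suc (∑-split x h members) ⟨
        1 + ∑ y members           ≤⟨ +-monoʳ-≤ 1 (∑≤count y) ⟩
        1 + c₂                    ∎

      below : ℝ.Lower δ (ℤ.+ c₂ ℚ./ y ℚ.- ℤ.+ 1 ℚ./ E)
      below = proj₁ (within y (≤-trans N≤x (m≤m+n x h)))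

      density-bound : c₂ * m * E ≤ (E + m) * y
      density-bound = subst₂ _≤_ (sym (*-assoc c₂ m E))
        (cong (_* y) (cong₂ _+_ (*-identityˡ E) (*-identityˡ m)))
        (<⇒≤ (fraction-<⁻¹ c₂ y (1 * E + 1 * m) (m * E) {{_}} {{m*n≢0 m E}}
          (subst (ℤ.+ c₂ ℚ./ y ℚ.<_) (+-fractions 1 m 1 E)
            (p-q<r⇒p<r+q {q = ℤ.+ 1 ℚ./ E} (lower<upper δ below δ<1/m)))))

      almost-constant : c₂ * x * E ≤ (c₁ * E + 2 * x) * y
      almost-constant = *-cancelʳ-≤ _ _ E (subst₂ _≤_
        (solve 3 (λ c x E → c :* (x :* E :* E) := c :* x :* E :* E) refl c₂ x E)
        (solve 4 (λ c x E y → ((c :* E :+ con 1 :* x) :* E :+ con 1 :* (x :* E)) :* y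
          := (c :* E :+ con 2 :* x) :* y :* E) refl c₁ x E y)
        (<⇒≤ (fraction-<⁻¹ c₂ y ((c₁ * E + 1 * x) * E + 1 * (x * E)) (x * E * E)
          (subst (ℤ.+ c₂ ℚ./ y ℚ.<_) (trans
              (cong (ℚ._+ ℤ.+ 1 ℚ./ E) (+-fractions c₁ x 1 E))
              (+-fractions (c₁ * E + 1 * x) (x * E) 1 E))
            (p-q<r⇒p<r+q {q = ℤ.+ 1 ℚ./ E}
              (lower<upper δ below (proj₂ (within x N≤x))))))))

-- Windows fitted to the sieve and to the leading digits

n<g^n : ∀ {g} → 2 ≤ g → ∀ n → n < g ^ n
n<g^n     2≤g zero    = ≤-refl
n<g^n {g} 2≤g (suc n) = begin
  2 + n           ≤⟨ +-mono-≤ (≤-trans (s≤s z≤n) (n<g^n 2≤g n)) (n<g^n 2≤g n) ⟩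
  g ^ n + g ^ n   ≡⟨ cong (g ^ n +_) (+-identityʳ (g ^ n)) ⟨
  2 * g ^ n       ≤⟨ *-monoˡ-≤ (g ^ n) 2≤g ⟩
  g * g ^ n       ∎
  where open ≤-Reasoning

m<[1+m/n]*n : ∀ m n .{{_ : NonZero n}} → m < suc (m / n) * n
m<[1+m/n]*n m n = subst (_< suc (m / n) * n) (sym (m≡m%n+[m/n]*n m n))
  (+-monoˡ-< (m / n * n) (m%n<n m n))

-- The window X ≤ r < X + H, of relative length about 1 / 4 D, chosen so that
-- X ≤ a < X + 2 H implies D G ≤ a < (D + 1) G.
record Window (Q D G : ℕ) : Set where
  field
    u v : ℕ
  X = Q * u
  H = Q * v
  field
    DG≤X   : D * G ≤ X
    X≤DG+H : X ≤ D * G + H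
    3H≤G   : 3 * H ≤ G
    G≤8H   : G ≤ 8 * H

-- `X` is the first multiple of `Q` beyond `D * G`, and `H` is `G / 4` rounded down to a multiple of
-- `Q`; multiples of `Q` keep the sieve counts exact. As `4 * Q ≤ G` gives `Q ≤ H`, one `H` absorbs
-- each rounding error of `Q`.
window : ∀ Q D G .{{_ : NonZero Q}} → 4 * Q ≤ G → Window Q D G
window Q D G 4Q≤G = record
  { u      = suc (D * G / Q)
  ; v      = v
  ; DG≤X   = subst (D * G ≤_) (*-comm (suc (D * G / Q)) Q) (<⇒≤ (m<[1+m/n]*n (D * G) Q))
  ; X≤DG+H = begin
      Q * suc (D * G / Q)   ≡⟨ *-suc Q (D * G / Q) ⟩
      Q + Q * (D * G / Q)   ≡⟨ cong (Q +_) (*-comm Q (D * G / Q)) ⟩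
      Q + D * G / Q * Q     ≤⟨ +-mono-≤ Q≤H (m/n*n≤m (D * G) Q) ⟩
      Q * v + D * G         ≡⟨ +-comm (Q * v) (D * G) ⟩
      D * G + Q * v         ∎
  ; 3H≤G   = begin
      3 * (Q * v)           ≤⟨ *-monoˡ-≤ (Q * v) (n≤1+n 3) ⟩
      4 * (Q * v)           ≡⟨ solve 2 (λ Q v → con 4 :* (Q :* v) := v :* (con 4 :* Q))
                                 refl Q v ⟩
      v * (4 * Q)           ≤⟨ m/n*n≤m G (4 * Q) ⟩
      G                     ∎
  ; G≤8H   = begin
      G                     ≤⟨ <⇒≤ (m<[1+m/n]*n G (4 * Q)) ⟩
      suc v * (4 * Q)       ≡⟨ solve 2 (λ Q v → (con 1 :+ v) :* (con 4 :* Q)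
                                 := con 4 :* Q :+ con 4 :* (Q :* v)) refl Q v ⟩
      4 * Q + 4 * (Q * v)   ≤⟨ +-monoˡ-≤ (4 * (Q * v)) (*-monoʳ-≤ 4 Q≤H) ⟩
      4 * (Q * v) + 4 * (Q * v)
                            ≡⟨ solve 1 (λ H → con 4 :* H :+ con 4 :* H := con 8 :* H)
                                 refl (Q * v) ⟩
      8 * (Q * v)           ∎
  }
  where
  open ≤-Reasoning
  instance
    _ : NonZero (4 * Q)
    _ = m*n≢0 4 Q
  v = G / (4 * Q)

  0<v : 0 < v
  0<v = *-cancelʳ-< (4 * Q) 0 v (+-cancelˡ-< (4 * Q) _ _
    (subst (_< 4 * Q + v * (4 * Q)) (sym (+-identityʳ (4 * Q)))
      (≤-<-trans 4Q≤G (m<[1+m/n]*n G (4 * Q)))))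

  Q≤H : Q ≤ Q * v
  Q≤H = m≤m*n Q v {{>-nonZero 0<v}}

-- For k-rough r in the window either 2 r counts for D or its divisors below l
-- have a sum of at least B, which happens rarely enough on average.
module Concentration {g} (2≤g : 2 ≤ g) (D : ℕ) .{{_ : NonZero D}} where

  leading : ℕ → ℕ
  leading n = 𝟙 (leadingSet? 2≤g D s n)

  -- A pointwise Markov inequality, ready to be summed. If the small divisors add up to less than
  -- `B`, then `r ≤ s (2 * r) < r + B` and `2 * r` is counted; otherwise their sum alone pays for
  -- the term `B`.
  rough⇒leading : ∀ {k r j l B} .{{_ : NonZero r}} → 2 * r < k * l →
    D * g ^ j ≤ r → r + B ≤ suc D * g ^ j →
    B * roughs k r ≤ B * leading (2 * r) + smallDivisorSum l (2 * r)
  rough⇒leading {k} {r} {j} {l} {B} 2r<kl lo hi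
    with rough? k r | smallDivisorSum l (2 * r) <? B
  ... | no  _     | _      = ≤-trans (≤-reflexive (*-zeroʳ B)) z≤n
  ... | yes _     | no b≮B =
    ≤-trans (≤-reflexive (*-identityʳ B)) (≤-trans (≮⇒≥ b≮B) (m≤n+m _ _))
  ... | yes rough | yes b<B = ≤-trans
    (≤-reflexive (cong (B *_) (sym (𝟙-yes (leadingSet? 2≤g D s (2 * r)) isLeading))))
    (m≤m+n _ _)
    where
    isLeading : LeadingSet g D s (2 * r)
    isLeading = *-monoʳ-≤ 2 (>-nonZero⁻¹ r) , j , ≤-trans lo (r≤s[2r] r) ,
      <-≤-trans (≤-<-trans (s[2r]≤ rough 2r<kl)
        (subst (smallDivisorSum l (2 * r) + r <_) (+-comm B r) (+-monoˡ-< r b<B))) hi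

  module _ {k Q a j} (sieves : Sieves k Q a) (w : Window Q D (g ^ j)) where

    open Window w

    ∑-roughs-window : ∑ H (λ i → roughs k (X + i)) ≡ a * v
    ∑-roughs-window = +-cancelˡ-≡ (a * u) _ _ (begin
      a * u + ∑ H (λ i → roughs k (X + i))
        ≡⟨ cong (_+ ∑ H (λ i → roughs k (X + i))) (∑-roughs sieves u) ⟨
      ∑ X (roughs k) + ∑ H (λ i → roughs k (X + i))
        ≡⟨ ∑-split X H (roughs k) ⟨
      ∑ (X + H) (roughs k)
        ≡⟨ cong (λ n → ∑ n (roughs k)) (*-distribˡ-+ Q u v) ⟨
      ∑ (Q * (u + v)) (roughs k)
        ≡⟨ ∑-roughs sieves (u + v) ⟩
      a * (u + v)
        ≡⟨ *-distribˡ-+ a u v ⟩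
      a * u + a * v ∎)
      where open ≡-Reasoning

    -- The pointwise bound is summed with `B = H`. Passing from `r` to `2 * r` doubles the window,
    -- and the odd members are thrown in since they only enlarge the right side.
    leading-lower-bound : ∀ {l} .{{_ : NonZero X}} → 2 * (X + H) ≤ k * l →
      H * (a * v) ≤ H * ∑ (2 * H) (λ i → leading (2 * X + i)) + l * (2 * H + l)
    leading-lower-bound {l} 2[X+H]≤kl = begin
      H * (a * v)
        ≡⟨ cong (H *_) ∑-roughs-window ⟨
      H * ∑ H (λ i → roughs k (X + i))
        ≡⟨ ∑-distribˡ-* H H _ ⟨
      ∑ H (λ i → H * roughs k (X + i))
        ≤⟨ ∑-mono H pointwise ⟩
      ∑ H (λ i → H * leading (2 * X + 2 * i) + smallDivisorSum l (2 * X + 2 * i))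
        ≡⟨ ∑-distrib-+ H _ _ ⟩
      ∑ H (λ i → H * leading (2 * X + 2 * i)) +
      ∑ H (λ i → smallDivisorSum l (2 * X + 2 * i))
        ≡⟨ cong (_+ ∑ H (λ i → smallDivisorSum l (2 * X + 2 * i))) (∑-distribˡ-* H H _) ⟩
      H * ∑ H (λ i → leading (2 * X + 2 * i)) +
      ∑ H (λ i → smallDivisorSum l (2 * X + 2 * i))
        ≤⟨ +-mono-≤ (*-monoʳ-≤ H (∑-double H (λ i → leading (2 * X + i))))
             (≤-trans (∑-double H (λ i → smallDivisorSum l (2 * X + i)))
               (∑-smallDivisorSum l (2 * X) (2 * H))) ⟩
      H * ∑ (2 * H) (λ i → leading (2 * X + i)) + l * (2 * H + l) ∎
      where
      open ≤-Reasoning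

      pointwise : ∀ i → i < H → H * roughs k (X + i) ≤
        H * leading (2 * X + 2 * i) + smallDivisorSum l (2 * X + 2 * i)
      pointwise i i<H = subst
        (λ n → H * roughs k (X + i) ≤ H * leading n + smallDivisorSum l n)
        (*-distribˡ-+ 2 X i)
        (rough⇒leading {k} {j = j} {{>-nonZero (≤-trans (>-nonZero⁻¹ X) (m≤m+n X i))}}
          (<-≤-trans (*-monoʳ-< 2 (+-monoʳ-< X i<H)) 2[X+H]≤kl)
          (≤-trans DG≤X (m≤m+n X i))
          (begin
            -- `X` overshoots `D * g ^ j` by at most `H`, and `i` and `B` cost another `H` each:
            -- this is why the window needs `3 * H ≤ G`.
            X + i + H                 ≤⟨ +-monoˡ-≤ H (+-mono-≤ X≤DG+H (<⇒≤ i<H)) ⟩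
            D * g ^ j + H + H + H     ≡⟨ solve 2 (λ x H → x :+ H :+ H :+ H
                                           := con 3 :* H :+ x) refl (D * g ^ j) H ⟩
            3 * H + D * g ^ j         ≤⟨ +-monoˡ-≤ (D * g ^ j) 3H≤G ⟩
            suc D * g ^ j             ∎))

-- Benford behaviour against the density of rough numbers

-- Compares two estimates of one count `W`: concentration forces it up to about `H * a / Q`, while
-- the Benford density `< 2 / D` on a window of length `2 * H` keeps it at `O(H / D)`.
benford⇒sparse : ∀ {g} (2≤g : 2 ≤ g) → IsBenford g 2≤g s →
  ∀ m .{{_ : NonZero m}} → let D = 2 * m in
  ∀ {k Q a} .{{_ : NonZero Q}} → Sieves k Q a → 20 * (D * D) ≤ k → D * a ≤ 14 * Q
benford⇒sparse {g} 2≤g benford m {k} {Q} {a} sieves 20D²≤k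
  = conclude (density⇒window (leadingSet? 2≤g D s) (log g 2≤g (suc D) D) (benford D) m E (log[1+1/2m]<1/m 2≤g m))
  where
  open ≤-Reasoning
  D = 2 * m
  -- The density error grows with the start of the window, which is of order `D * H`. This `E` makes
  -- it cost one `H` in `DW≤6H`.
  E = 40 * (D * D)

  instance
    D≢0 : NonZero D
    D≢0 = m*n≢0 2 m

    E≢0 : NonZero E
    E≢0 = m*n≢0 40 (D * D) {{_}} {{m*n≢0 D D}}

  open Concentration 2≤g D

  conclude : (∃ λ N → ∀ x h .{{_ : NonZero x}} → N ≤ x →
    m * E * ∑ h (λ i → leading (x + i)) ≤ h * (E + m) + 2 * m * x + m * E) →
    D * a ≤ 14 * Q
  conclude (N , bound) = *-cancelʳ-≤ _ _ (H * H) {{m*n≢0 H H {{H≢0}} {{H≢0}}}} (begin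
    D * a * (H * H)
      ≡⟨ solve 4 (λ D a Q v → D :* a :* (Q :* v :* (Q :* v))
           := D :* Q :* (Q :* v :* (a :* v))) refl D a Q v ⟩
    D * Q * (H * (a * v))
      ≤⟨ *-monoʳ-≤ (D * Q) (leading-lower-bound {j = j} sieves w {l} {{X≢0}} 2[X+H]≤kl) ⟩
    D * Q * (H * W + l * (2 * H + l))
      ≡⟨ solve 5 (λ D Q H W l → D :* Q :* (H :* W :+ l :* (con 2 :* H :+ l))
           := Q :* (H :* (D :* W) :+ D :* l :* (con 2 :* H :+ l))) refl D Q H W l ⟩
    Q * (H * (D * W) + D * l * (2 * H + l))
      -- The 14 is 6 from the Benford bound plus `2 * 4` from the small divisors.
      ≤⟨ *-monoʳ-≤ Q (+-mono-≤ (*-monoʳ-≤ H DW≤6H) (*-mono-≤ Dl≤2H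
           (+-monoʳ-≤ (2 * H) (≤-trans (m≤n*m l D) Dl≤2H)))) ⟩
    Q * (H * (6 * H) + 2 * H * (2 * H + 2 * H))
      ≡⟨ solve 2 (λ Q H → Q :* (H :* (con 6 :* H) :+ con 2 :* H :* (con 2 :* H :+ con 2 :* H))
           := con 14 :* Q :* (H :* H)) refl Q H ⟩
    14 * Q * (H * H) ∎)
    where
    -- As `j < g ^ j`, the summands put the window beyond `N`, make it exist, and ensure `D ≤ H`.
    j = N + 4 * Q + 8 * D
    G = g ^ j

    j≤G : j ≤ G
    j≤G = <⇒≤ (n<g^n 2≤g j)

    w : Window Q D G
    w = window Q D G (≤-trans (m≤n+m (4 * Q) N) (≤-trans (m≤m+n _ (8 * D)) j≤G))

    open Window w

    W = ∑ (2 * H) (λ i → leading (2 * X + i))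
    -- About `H / D`: small enough for the divisor sums to cost `O(H / D)`, yet large enough for
    -- `2 * (X + H) ≤ k * l` once `k ≥ 20 * (D * D)`.
    l = suc (H / D)

    D≤H : D ≤ H
    D≤H = *-cancelˡ-≤ 8 (≤-trans (m≤n+m (8 * D) (N + 4 * Q)) (≤-trans j≤G G≤8H))

    H≢0 : NonZero H
    H≢0 = >-nonZero (≤-trans (>-nonZero⁻¹ D) D≤H)

    N≤X : N ≤ X
    N≤X = begin
      N        ≤⟨ ≤-trans (m≤m+n N (4 * Q)) (≤-trans (m≤m+n _ (8 * D)) j≤G) ⟩
      G        ≤⟨ m≤n*m G D ⟩
      D * G    ≤⟨ DG≤X ⟩
      X        ∎

    X≢0 : NonZero X
    X≢0 = >-nonZero (≤-trans (>-nonZero⁻¹ D) (begin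
      D        ≤⟨ m≤m*n D G {{m^n≢0 g j {{>-nonZero (<⇒≤ 2≤g)}}}} ⟩
      D * G    ≤⟨ DG≤X ⟩
      X        ∎))

    X+H≤10DH : X + H ≤ 10 * (D * H)
    X+H≤10DH = begin
      X + H                     ≤⟨ +-monoˡ-≤ H X≤DG+H ⟩
      D * G + H + H             ≤⟨ +-monoˡ-≤ H (+-monoˡ-≤ H (*-monoʳ-≤ D G≤8H)) ⟩
      D * (8 * H) + H + H       ≤⟨ +-mono-≤ (+-monoʳ-≤ (D * (8 * H)) (m≤n*m H D)) (m≤n*m H D) ⟩
      D * (8 * H) + D * H + D * H
        ≡⟨ solve 2 (λ D H → D :* (con 8 :* H) :+ D :* H :+ D :* H
             := con 10 :* (D :* H)) refl D H ⟩
      10 * (D * H)              ∎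

    H≤Dl : H ≤ D * l
    H≤Dl = subst (H ≤_) (*-comm l D) (<⇒≤ (m<[1+m/n]*n H D))

    Dl≤2H : D * l ≤ 2 * H
    Dl≤2H = begin
      D * suc (H / D)      ≡⟨ *-comm D (suc (H / D)) ⟩
      D + H / D * D        ≤⟨ +-mono-≤ D≤H (m/n*n≤m H D) ⟩
      H + H                ≡⟨ cong (H +_) (+-identityʳ H) ⟨
      2 * H                ∎

    2[X+H]≤kl : 2 * (X + H) ≤ k * l
    2[X+H]≤kl = begin
      2 * (X + H)          ≤⟨ *-monoʳ-≤ 2 X+H≤10DH ⟩
      2 * (10 * (D * H))   ≤⟨ *-monoʳ-≤ 2 (*-monoʳ-≤ 10 (*-monoʳ-≤ D H≤Dl)) ⟩
      2 * (10 * (D * (D * l)))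
        ≡⟨ solve 2 (λ D l → con 2 :* (con 10 :* (D :* (D :* l)))
             := con 20 :* (D :* D) :* l) refl D l ⟩
      20 * (D * D) * l     ≤⟨ *-monoˡ-≤ l 20D²≤k ⟩
      k * l                ∎

    DW≤6H : D * W ≤ 6 * H
    DW≤6H = *-cancelˡ-≤ E (begin
      E * (D * W)
        ≡⟨ solve 3 (λ E m W → E :* (con 2 :* m :* W) := con 2 :* (m :* E :* W)) refl E m W ⟩
      2 * (m * E * W)
        ≤⟨ *-monoʳ-≤ 2 (bound (2 * X) (2 * H) {{m*n≢0 2 X {{_}} {{X≢0}}}}
             (≤-trans N≤X (m≤n*m X 2))) ⟩
      2 * (2 * H * (E + m) + 2 * m * (2 * X) + m * E)
        ≡⟨ solve 4 (λ H E m X →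
             con 2 :* (con 2 :* H :* (E :+ m) :+ con 2 :* m :* (con 2 :* X) :+ m :* E) :=
             con 4 :* (H :* E) :+ con 4 :* (con 2 :* m :* X) :+ con 2 :* (con 2 :* m :* H)
               :+ con 2 :* m :* E) refl H E m X ⟩
      -- Of the final 6, the main term gives 4, the endpoint term `D * E ≤ H * E` gives 1, and the
      -- density errors, merged into `4 * (D * (X + H))`, give 1.
      4 * (H * E) + 4 * (D * X) + 2 * (D * H) + D * E
        ≤⟨ +-mono-≤ (+-monoʳ-≤ (4 * (H * E) + 4 * (D * X))
             (*-monoˡ-≤ (D * H) {2} {4} (s≤s (s≤s z≤n)))) (*-monoˡ-≤ E D≤H) ⟩
      4 * (H * E) + 4 * (D * X) + 4 * (D * H) + H * E
        ≡⟨ solve 4 (λ x D X H → con 4 :* x :+ con 4 :* (D :* X) :+ con 4 :* (D :* H) :+ x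
             := con 5 :* x :+ con 4 :* (D :* (X :+ H))) refl (H * E) D X H ⟩
      5 * (H * E) + 4 * (D * (X + H))
        ≤⟨ +-monoʳ-≤ (5 * (H * E)) (*-monoʳ-≤ 4 (*-monoʳ-≤ D X+H≤10DH)) ⟩
      5 * (H * E) + 4 * (D * (10 * (D * H)))
        ≡⟨ cong (5 * (H * E) +_) (solve 2 (λ D H → con 4 :* (D :* (con 10 :* (D :* H)))
             := con 40 :* (D :* D) :* H) refl D H) ⟩
      5 * (H * E) + E * H
        ≡⟨ solve 2 (λ H E → con 5 :* (H :* E) :+ E :* H := E :* (con 6 :* H)) refl H E ⟩
      E * (6 * H) ∎)

^-distribʳ-* : ∀ m n o → (m * n) ^ o ≡ m ^ o * n ^ o
^-distribʳ-* m n zero    = refl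
^-distribʳ-* m n (suc o) = trans (cong (m * n *_) (^-distribʳ-* m n o))
  (solve 4 (λ m n x y → m :* n :* (x :* y) := m :* x :* (n :* y)) refl
    m n (m ^ o) (n ^ o))

-- Cubing the first hypothesis gives `D³ a³ ≤ e³ Q³ ≤ e³ b c D² a³`, and `D² a³` cancels: a density
-- of order `k^(-1/3)` with `k` of order `D²` beats `1 / D`.
sparse∧dense⇒≤ : ∀ b c e D Q a .{{_ : NonZero D}} .{{_ : NonZero Q}} →
  D * a ≤ e * Q → Q ^ 3 ≤ b * (c * (D * D)) * a ^ 3 → D ≤ e ^ 3 * b * c
sparse∧dense⇒≤ b c e D Q a Da≤eQ Q³≤ =
  *-cancelʳ-≤ _ _ (D * D * a ^ 3) {{m*n≢0 (D * D) (a ^ 3) {{m*n≢0 D D}} {{a³≢0}}}} (begin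
    D * (D * D * a ^ 3)
      ≡⟨ solve 2 (λ D a → D :* (D :* D :* a :^ 3) := (D :* a) :^ 3) refl D a ⟩
    (D * a) ^ 3
      ≤⟨ ^-monoˡ-≤ 3 Da≤eQ ⟩
    (e * Q) ^ 3
      ≡⟨ ^-distribʳ-* e Q 3 ⟩
    e ^ 3 * Q ^ 3
      ≤⟨ *-monoʳ-≤ (e ^ 3) Q³≤ ⟩
    e ^ 3 * (b * (c * (D * D)) * a ^ 3)
      ≡⟨ solve 5 (λ e b c d a → e :* (b :* (c :* d) :* a) := e :* b :* c :* (d :* a)) refl
           (e ^ 3) b c (D * D) (a ^ 3) ⟩
    e ^ 3 * b * c * (D * D * a ^ 3) ∎)
  where
  open ≤-Reasoning
  a³≢0 : NonZero (a ^ 3)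
  -- With `a = 0` the second hypothesis would bound the positive `Q ^ 3` by 0.
  a³≢0 = m*n≢0⇒n≢0 (b * (c * (D * D)))
    {{>-nonZero (≤-trans (m^n>0 Q 3) Q³≤)}}

benford⇒bounded : ∀ {g} (2≤g : 2 ≤ g) → IsBenford g 2≤g s →
  ∀ m .{{_ : NonZero m}} → 2 * m ≤ 14 ^ 3 * 84 * 4
benford⇒bounded 2≤g benford m =
  sparse∧dense⇒≤ 84 4 14 D modulus residues {{D≢0}} {{modulus≢0}}
    (benford⇒sparse 2≤g benford m {Q = modulus} {{modulus≢0}} sieves 20D²≤k)
    (subst (λ i → modulus ^ 3 ≤ 84 * i * residues ^ 3) i≡4D² dense)
  where
  D = 2 * m
  D≢0 = m*n≢0 2 m
  -- The wheel reaches past `6 * suc i = 24 * (D * D)`; 4 is the least factor whose sixfold is at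
  -- least 20.
  i = pred (4 * (D * D))

  i≡4D² : suc i ≡ 4 * (D * D)
  i≡4D² = suc-pred (4 * (D * D)) {{m*n≢0 4 (D * D) {{_}} {{m*n≢0 D D {{D≢0}} {{D≢0}}}}}}

  open Wheel (wheel i)

  20D²≤k : 20 * (D * D) ≤ 5 + 6 * suc i
  20D²≤k = begin
    20 * (D * D)         ≤⟨ *-monoˡ-≤ (D * D) (m≤m+n 20 4) ⟩
    24 * (D * D)         ≡⟨ *-assoc 6 4 (D * D) ⟩
    6 * (4 * (D * D))    ≡⟨ cong (6 *_) i≡4D² ⟨
    6 * suc i            ≤⟨ m≤n+m (6 * suc i) 5 ⟩
    5 + 6 * suc i        ∎
    where open ≤-Reasoning

proposition3p6 : (g : ℕ) (2≤g : 2 ≤ g) → ¬ IsBenford g 2≤g s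
proposition3p6 g 2≤g benford =
  -- The bound is 921984, so `D = 1000000` already violates it.
  <⇒≱ (<ᵇ⇒< (14 ^ 3 * 84 * 4) (2 * 500000) _) (benford⇒bounded 2≤g benford 500000)
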